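{- Let $n\geq 3$ and $1\leq r\leq n-2$ be integers. For every $G_n\in HL_n$, we have $sm_\lambda^r(G_n)=2^r(n-r)-n$.
   Context: Hypercube-like networks (HL-networks) are defined recursively: $HL_0=\{K_1\}$ (a single vertex), and for $n\geq 1$, $HL_n$ is the set of all graphs $G_{n-1}\oplus G'_{n-1}$ with $G_{n-1},G'_{n-1}\in HL_{n-1}$, where $G_{n-1}\oplus G'_{n-1}$ denotes the graph obtained from the disjoint union of $G_{n-1}$ and $G'_{n-1}$ by adding the edges of an arbitrary perfect matching between $V(G_{n-1})$ and $V(G'_{n-1})$ (i.e. the edges $\{x,\phi(x)\}$ for some bijection $\phi:V(G_{n-1})\to V(G'_{n-1})$). Every $G_n\in HL_n$ is an $n$-regular graph on $2^n$ vertices. A connected graph $G$ is strongly Menger edge connected (SM-$\lambda$) if for every pair of distinct vertices $u,v$ of $G$ there are $\min\{\deg_G(u),\deg_G(v)\}$ pairwise edge-disjoint $u$,$v$-paths in $G$. For a graph $G$ and integer $r\geq 0$, $sm_\lambda^r(G)$ is the maximum integer $m$ such that for every edge subset $F\subseteq E(G)$ with $|F|\leq m$ and $\delta(G-F)\geq r$ (where $\delta$ denotes minimum degree), the graph $G-F$ is SM-$\lambda$. -}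

module Defs where

open import Data.Nat using (ℕ; zero; suc; _+_; _≤_; _<ᵇ_; _⊓_)
open import Data.Bool using (Bool; true; false; _∧_; not; if_then_else_)
open import Data.Fin using (Fin; toℕ; splitAt)
open import Data.Fin.Properties using (_≟_)
open import Data.Sum using (_⊎_; inj₁; inj₂)
open import Data.Product using (Σ; _×_; _,_)
open import Data.List using (List; []; _∷_)
open import Data.List.Membership.Propositional using (_∈_)
open import Data.List.Relation.Unary.Unique.Propositional using (Unique)
open import Data.Empty using (⊥)
open import Relation.Binary.PropositionalEquality using (_≡_; _≢_)
open import Relation.Nullary.Decidable using (⌊_⌋)
open import Function.Bundles using (_⤖_; Bijection)

-- Simple graphs on the vertex set Fin N, given by a Bool-valued
-- adjacency function (intended symmetric and irreflexive).

Adj : ℕ → Set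
Adj N = Fin N → Fin N → Bool

countB : {N : ℕ} → (Fin N → Bool) → ℕ
countB {zero}  f = 0
countB {suc N} f = (if f Fin.zero then 1 else 0) + countB (λ j → f (Fin.suc j))

deg : {N : ℕ} → Adj N → Fin N → ℕ
deg G v = countB (G v)

MinDegAtLeast : {N : ℕ} → ℕ → Adj N → Set
MinDegAtLeast r G = ∀ v → r ≤ deg G v

EdgeSubset : {N : ℕ} → Adj N → Adj N → Set
EdgeSubset G F = (∀ i j → F i j ≡ F j i) × (∀ i j → F i j ≡ true → G i j ≡ true)

edgeCount : {N : ℕ} → Adj N → ℕ
edgeCount {N} F = countSum (λ i → countB (λ j → F i j ∧ (toℕ i <ᵇ toℕ j)))
  where
  countSum : {M : ℕ} → (Fin M → ℕ) → ℕ
  countSum {zero}  g = 0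
  countSum {suc M} g = g Fin.zero + countSum (λ i → g (Fin.suc i))

_─_ : {N : ℕ} → Adj N → Adj N → Adj N
(G ─ F) i j = G i j ∧ not (F i j)

data Walk {N : ℕ} (G : Adj N) : Fin N → Fin N → Set where
  [] : ∀ {u} → Walk G u u
  _∷_ : ∀ {u w v} → G u w ≡ true → Walk G w v → Walk G u v

vertices : ∀ {N} {G : Adj N} {u v} → Walk G u v → List (Fin N)
vertices {u = u} []      = u ∷ []
vertices {u = u} (_ ∷ p) = u ∷ vertices p

edges : ∀ {N} {G : Adj N} {u v} → Walk G u v → List (Fin N × Fin N)
edges []                    = []
edges {u = u} (_∷_ {w = w} _ p) = (u , w) ∷ edges p

IsPath : ∀ {N} {G : Adj N} {u v} → Walk G u v → Set
IsPath p = Unique (vertices p)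

EdgeDisjoint : ∀ {N} {G : Adj N} {u v u' v'} → Walk G u v → Walk G u' v' → Set
EdgeDisjoint {N} p q = ∀ (a b : Fin N) → (a , b) ∈ edges p →
  ((a , b) ∈ edges q ⊎ (b , a) ∈ edges q) → ⊥

Connected : {N : ℕ} → Adj N → Set
Connected G = ∀ u v → Walk G u v

SMλ : {N : ℕ} → Adj N → Set
SMλ {N} G = Connected G ×
  (∀ (u v : Fin N) → u ≢ v →
    Σ (Fin (deg G u ⊓ deg G v) → Walk G u v) λ ps →
      (∀ i → IsPath (ps i)) × (∀ i j → i ≢ j → EdgeDisjoint (ps i) (ps j)))

SmGood : {N : ℕ} → ℕ → Adj N → ℕ → Set
SmGood {N} r G m = ∀ (F : Adj N) → EdgeSubset G F → edgeCount F ≤ m →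
  MinDegAtLeast r (G ─ F) → SMλ (G ─ F)

SmλrIs : {N : ℕ} → ℕ → Adj N → ℕ → Set
SmλrIs r G m = SmGood r G m × (∀ k → SmGood r G k → k ≤ m)

V : ℕ → ℕ
V zero    = 1
V (suc n) = V n + V n

⊕ : {m : ℕ} → Adj m → Adj m → (Fin m ⤖ Fin m) → Adj (m + m)
⊕ {m} A B φ i j with splitAt m i | splitAt m j
... | inj₁ a | inj₁ b = A a b
... | inj₂ a | inj₂ b = B a b
... | inj₁ a | inj₂ b = ⌊ Bijection.to φ a ≟ b ⌋
... | inj₂ a | inj₁ b = ⌊ Bijection.to φ b ≟ a ⌋

data HL : (n : ℕ) → Adj (V n) → Set where
  hl0 : HL zero (λ _ _ → false)
  hlS : ∀ {n A B} → HL n A → HL n B → (φ : Fin (V n) ⤖ Fin (V n)) →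
        HL (suc n) (⊕ A B φ)

{-# OPTIONS --safe #-}

-- A vertex set X of size x in an n-dimensional HL-network induces a degree sum
-- of at most D n x (the value for an initial segment of the hypercube), because
-- D is superadditive with respect to the matching edges. If |F| ≤ 2^r (n - r) - n
-- and δ(G - F) ≥ r, then every cut X of G - F with at most half of the vertices has
-- at least deg u edges for each u ∈ X: for |X| ≥ 2^r the boundary of X in G already
-- has 2^r (n - r) edges, and for |X| < 2^r at most (|X| - 1) r of the degree sum
-- of X is spent inside X. Menger's theorem then gives the paths.
-- The bound is sharp: for an r-dimensional subcube X, remove all but n - 1 of its
-- 2^r (n - r) boundary edges, keeping those at some u ∈ X; then u and one of its
-- neighbours outside X both have degree n but are separated by n - 1 edges.
module Submission where

open import Defs
open import Data.Bool using (Bool; T; true; false; _∧_; _∨_; not; if_then_else_)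
open import Data.Bool.Properties using (∧-identityʳ; ∧-zeroʳ; ∨-comm; ¬-not) renaming (_≟_ to _≟ᵇ_)
open import Data.Empty using (⊥; ⊥-elim)
open import Data.Fin using (Fin; zero; suc; toℕ; fromℕ<; splitAt; _↑ˡ_; _↑ʳ_)
open import Data.Fin.Properties using (_≟_; any?; splitAt-↑ˡ; splitAt-↑ʳ; splitAt⁻¹-↑ˡ; splitAt⁻¹-↑ʳ; toℕ-injective; suc-injective; 0≢1+n)
import Data.List
open import Data.List.Membership.Propositional using (_∈_)
open import Data.List.Relation.Unary.Unique.Propositional using (Unique)
open import Data.List.Relation.Unary.All as All using (All; []; _∷_)
open import Data.List.Relation.Unary.All.Properties using (All¬⇒¬Any)
open import Data.List.Relation.Unary.AllPairs using ([]; _∷_)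
open import Data.List.Relation.Unary.Any using (here; there)
open import Data.Nat using (ℕ; zero; suc; _+_; _*_; _∸_; _^_; _≤_; _<_; _<ᵇ_; _⊓_; z≤n; s≤s; ⌊_/2⌋; ⌈_/2⌉)
open import Data.Nat.Properties hiding (_≟_; suc-injective; 0≢1+n)
open import Data.Nat.Tactic.RingSolver using (solve-∀)
open import Data.Product using (Σ; ∃; _×_; _,_; proj₁; proj₂)
open import Data.Sum using (_⊎_; inj₁; inj₂; [_,_]′)
open import Function using (_∘_; flip; const)
open import Function.Bundles using (_⤖_; Bijection)
open import Relation.Binary.PropositionalEquality
open import Relation.Binary using (tri<; tri≈; tri>)
open import Relation.Nullary using (¬_; yes; no; contradiction)
open import Relation.Nullary.Decidable using (⌊_⌋; _×-dec_)
open import Algebra.Properties.Semiring.Sum +-*-semiring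
  using (sum; ∑-distrib-+; ∑-comm; sum-cong-≗; *-distribˡ-sum)

-- Counting

-- The constant has two sources. The boundary of an r-dimensional subcube has 2^r (n - r) edges, the
-- minimum over all sets of 2^r to 2^(n-1) vertices, and n bounds every degree in G - F, so a cut
-- that retains n edges is large enough for every u. A set of fewer than 2^r vertices can have a
-- smaller boundary than this, and the size of F then says nothing; there the minimum degree must
-- supply the cut edges. The obstacle in bounding induced degree sums is that the last matching
-- divides X into two parts of arbitrary sizes, whereas the recursion of `D` divides x almost
-- equally, by the lowest binary digit. Superadditivity reconciles the two. In the sharpness example
-- n - 1 arises as (n - r) + (r - 1): all n - r boundary edges at u stay, and one edge at each of r
-- - 1 further vertices of X. The subcube lies in one half of the last decomposition, and the vertex
-- paired with u is its partner in the last matching: u is its only neighbour in X, so it loses no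
-- edge.

ind : Bool → ℕ
ind b = if b then 1 else 0

VSet : ℕ → Set
VSet N = Fin N → Bool

# : ∀ {N} → VSet N → ℕ
# X = sum (ind ∘ X)

card₂ : ∀ {M N} → (Fin M → Fin N → Bool) → ℕ
card₂ f = sum (# ∘ f)

countB≡# : ∀ {N} (f : VSet N) → countB f ≡ # f
countB≡# {zero} f = refl
countB≡# {suc N} f = cong (ind (f zero) +_) (countB≡# (f ∘ suc))

sum-mono : ∀ {N} {f g : Fin N → ℕ} → (∀ i → f i ≤ g i) → sum f ≤ sum g
sum-mono {zero} h = z≤n
sum-mono {suc N} h = +-mono-≤ (h zero) (sum-mono (h ∘ suc))

sum-mono-+ : ∀ {N} {f g h : Fin N → ℕ} → (∀ i → f i ≤ g i + h i) → sum f ≤ sum g + sum h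
sum-mono-+ {g = g} {h} p = ≤-trans (sum-mono p) (≤-reflexive (∑-distrib-+ g h))

sum-cong-+ : ∀ {N} {f g h : Fin N → ℕ} → (∀ i → f i ≡ g i + h i) → sum f ≡ sum g + sum h
sum-cong-+ {g = g} {h} p = trans (sum-cong-≗ p) (∑-distrib-+ g h)

sum-zero : ∀ N → sum {N} (const 0) ≡ 0
sum-zero zero = refl
sum-zero (suc N) = sum-zero N

sum-one : ∀ N → sum {N} (const 1) ≡ N
sum-one zero = refl
sum-one (suc N) = cong suc (sum-one N)

term≤sum : ∀ {N} (f : Fin N → ℕ) i → f i ≤ sum f
term≤sum f zero = m≤m+n _ _
term≤sum f (suc i) = ≤-trans (term≤sum (f ∘ suc) i) (m≤n+m _ _)

sum-splitAt : ∀ m {n} (f : Fin (m + n) → ℕ) →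
  sum f ≡ sum (λ i → f (i ↑ˡ n)) + sum (λ i → f (m ↑ʳ i))
sum-splitAt zero f = refl
sum-splitAt (suc m) f = trans (cong (f zero +_) (sum-splitAt m (f ∘ suc))) (sym (+-assoc (f zero) _ _))

#-cong : ∀ {N} {f g : VSet N} → (∀ i → f i ≡ g i) → # f ≡ # g
#-cong h = sum-cong-≗ (cong ind ∘ h)

#-empty : ∀ {N} {f : VSet N} → (∀ i → f i ≡ false) → # f ≡ 0
#-empty {N} h = trans (#-cong h) (sum-zero N)

member⇒1≤# : ∀ {N} (f : VSet N) i → f i ≡ true → 1 ≤ # f
member⇒1≤# f i fi = subst (λ b → ind b ≤ # f) fi (term≤sum (ind ∘ f) i)

1≤#⇒member : ∀ {N} (f : VSet N) → 1 ≤ # f → ∃ λ i → f i ≡ true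
1≤#⇒member {suc N} f h with f zero in eq
... | true = zero , eq
... | false = let i , fi = 1≤#⇒member (f ∘ suc) h in suc i , fi

#≤1 : ∀ {N} (f : VSet N) → (∀ i j → f i ≡ true → f j ≡ true → i ≡ j) → # f ≤ 1
#≤1 {zero} f h = z≤n
#≤1 {suc N} f h with f zero in eq
... | false = #≤1 (f ∘ suc) (λ i j p q → suc-injective (h (suc i) (suc j) p q))
... | true = ≤-reflexive (cong suc (#-empty {f = f ∘ suc} λ i → ¬-not λ p → 0≢1+n (h zero (suc i) eq p)))

#≡1 : ∀ {N} (f : VSet N) i → f i ≡ true → (∀ i j → f i ≡ true → f j ≡ true → i ≡ j) → # f ≡ 1
#≡1 f i fi h = ≤-antisym (#≤1 f h) (member⇒1≤# f i fi)

⌊≟⌋-refl : ∀ {N} (i : Fin N) → ⌊ i ≟ i ⌋ ≡ true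
⌊≟⌋-refl i with i ≟ i
... | yes _ = refl
... | no i≢i = contradiction refl i≢i

⌊≟⌋-sound : ∀ {N} {i j : Fin N} → ⌊ i ≟ j ⌋ ≡ true → i ≡ j
⌊≟⌋-sound {i = i} {j} h with i ≟ j
⌊≟⌋-sound h | yes p = p
⌊≟⌋-sound () | no _

⌊≟⌋-≢ : ∀ {N} {i j : Fin N} → i ≢ j → ⌊ i ≟ j ⌋ ≡ false
⌊≟⌋-≢ i≢j = ¬-not (i≢j ∘ ⌊≟⌋-sound)

#-singleton : ∀ {N} (i : Fin N) → # (λ j → ⌊ i ≟ j ⌋) ≡ 1
#-singleton i = #≡1 _ i (⌊≟⌋-refl i) (λ j k p q → trans (sym (⌊≟⌋-sound p)) (⌊≟⌋-sound q))

#-∧ˡ : ∀ {N} a (w : Fin N) → # (λ j → a ∧ ⌊ w ≟ j ⌋) ≡ ind a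
#-∧ˡ true w = #-singleton w
#-∧ˡ {N} false w = sum-zero N

∧-∧-zeroʳ : ∀ a b → a ∧ (b ∧ false) ≡ false
∧-∧-zeroʳ a b = trans (cong (a ∧_) (∧-zeroʳ b)) (∧-zeroʳ a)

∧-left : ∀ {a b} → a ∧ b ≡ true → a ≡ true
∧-left {true} _ = refl

∧-right : ∀ {a b} → a ∧ b ≡ true → b ≡ true
∧-right {true} h = h

not-true : ∀ {a} → not a ≡ true → a ≡ false
not-true {false} _ = refl

true≢false : ∀ {a} → a ≡ true → a ≡ false → ⊥
true≢false refl ()

#-complement : ∀ {N} (X : VSet N) → # X + # (not ∘ X) ≡ N
#-complement {N} X = trans (sym (sum-cong-+ (λ i → lem (X i)))) (sum-one N)
  where
  lem : ∀ b → 1 ≡ ind b + ind (not b)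
  lem true = refl
  lem false = refl

subset-of-size : ∀ {N} (X : VSet N) k → k ≤ # X →
  Σ (VSet N) λ S → (∀ i → S i ≡ true → X i ≡ true) × # S ≡ k
subset-of-size {N} X zero h = const false , (λ _ ()) , sum-zero N
subset-of-size {suc N} X (suc k) h with X zero in eq
... | true = let S , S⊆X , #S = subset-of-size (X ∘ suc) k (≤-pred h) in
  (λ { zero → true ; (suc i) → S i }) , (λ { zero _ → eq ; (suc i) → S⊆X i }) , cong suc #S
... | false = let S , S⊆X , #S = subset-of-size (X ∘ suc) (suc k) h in
  (λ { zero → false ; (suc i) → S i }) , (λ { zero () ; (suc i) → S⊆X i }) , #S

card₂-cong-+ : ∀ {M N} {f g h : Fin M → Fin N → Bool} →
  (∀ i j → ind (f i j) ≡ ind (g i j) + ind (h i j)) → card₂ f ≡ card₂ g + card₂ h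
card₂-cong-+ p = sum-cong-+ (sum-cong-+ ∘ p)

card₂-mono-+ : ∀ {M N} {f g h : Fin M → Fin N → Bool} →
  (∀ i j → ind (f i j) ≤ ind (g i j) + ind (h i j)) → card₂ f ≤ card₂ g + card₂ h
card₂-mono-+ p = sum-mono-+ (sum-mono-+ ∘ p)

card₂-mono : ∀ {M N} {f g : Fin M → Fin N → Bool} →
  (∀ i j → ind (f i j) ≤ ind (g i j)) → card₂ f ≤ card₂ g
card₂-mono p = sum-mono (sum-mono ∘ p)

card₂-cong : ∀ {M N} {f g : Fin M → Fin N → Bool} →
  (∀ i j → f i j ≡ g i j) → card₂ f ≡ card₂ g
card₂-cong p = sum-cong-≗ (#-cong ∘ p)

card₂-swap : ∀ {M N} (f : Fin M → Fin N → Bool) → card₂ f ≡ card₂ (flip f)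
card₂-swap f = ∑-comm (λ i j → ind (f i j))

private
  rowAbove : ∀ {N} → Adj N → Fin N → ℕ
  rowAbove F i = countB (λ j → F i j ∧ (toℕ i <ᵇ toℕ j))

  -- The summation used by edgeCount is local to its where-block and cannot
  -- be named, so rowSum is left to be inferred from its use in edgeCount-sum.
  mutual
    rowSum : (P : ℕ) (F : Adj P) (M : ℕ) → (Fin M → ℕ) → ℕ
    rowSum = _

    edgeCount-sum : ∀ {N} (F : Adj N) → edgeCount F ≡ sum (rowAbove F)
    edgeCount-sum {zero} F = refl
    edgeCount-sum {suc M} F with rowAbove F zero | rowAbove F ∘ suc
    ... | x | g with suc M | F
    ... | P | H = cong (x +_) (rowSum≡sum P H M g)

    rowSum≡sum : ∀ P F M g → rowSum P F M g ≡ sum g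
    rowSum≡sum P F zero g = refl
    rowSum≡sum P F (suc M) g = cong (g zero +_) (rowSum≡sum P F M _)

edgeCount≡card₂ : ∀ {N} (F : Adj N) → edgeCount F ≡ card₂ (λ i j → F i j ∧ (toℕ i <ᵇ toℕ j))
edgeCount≡card₂ F = trans (edgeCount-sum F) (sum-cong-≗ λ i → countB≡# (λ j → F i j ∧ (toℕ i <ᵇ toℕ j)))

-- Arithmetic of the extremal function

-- D n x is the largest degree sum of a graph induced by x ≤ 2 ^ n vertices of
-- an n-dimensional HL-network, that is, twice the number of ones in the
-- binary expansions of 0, …, x ∸ 1.
D : ℕ → ℕ → ℕ
D zero x = 0
D (suc n) x = D n ⌊ x /2⌋ + D n ⌈ x /2⌉ + (⌊ x /2⌋ + ⌊ x /2⌋)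

⌊p+p/2⌋ : ∀ p → ⌊ p + p /2⌋ ≡ p
⌊p+p/2⌋ p = sym (n≡⌊n+n/2⌋ p)

⌈p+p/2⌉ : ∀ p → ⌈ p + p /2⌉ ≡ p
⌈p+p/2⌉ p = sym (n≡⌈n+n/2⌉ p)

D-even : ∀ n p → D (suc n) (p + p) ≡ D n p + D n p + (p + p)
D-even n p rewrite ⌊p+p/2⌋ p | ⌈p+p/2⌉ p = refl

D-odd : ∀ n p → D (suc n) (suc (p + p)) ≡ D n p + D n (suc p) + (p + p)
D-odd n p rewrite ⌊p+p/2⌋ p | ⌈p+p/2⌉ p = refl

data Parity : ℕ → Set where
  even : ∀ p → Parity (p + p)
  odd  : ∀ p → Parity (suc (p + p))

parity : ∀ n → Parity n
parity zero = even zero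
parity (suc n) with parity n
... | even p = odd p
... | odd p = subst Parity (cong suc (+-suc p p)) (even (suc p))

half-≤ : ∀ {p s} → p + p ≤ suc (s + s) → p ≤ s
half-≤ {zero} _ = z≤n
half-≤ {suc p} {zero} (s≤s h) rewrite +-suc p p = contradiction h λ ()
half-≤ {suc p} {suc s} (s≤s h) rewrite +-suc p p | +-suc s s = s≤s (half-≤ (≤-pred h))

half-< : ∀ {p s} → p + p < s + s → p < s
half-< {p} {s} h = ≰⇒> λ s≤p → <⇒≱ h (+-mono-≤ s≤p s≤p)

D-0 : ∀ n → D n 0 ≡ 0
D-0 zero = refl
D-0 (suc n) = trans (D-even n 0) (cong (λ z → z + z + 0) (D-0 n))

D-1 : ∀ n → D n 1 ≡ 0
D-1 zero = refl
D-1 (suc n) = trans (D-odd n 0) (cong₂ (λ y z → y + z + 0) (D-0 n) (D-1 n))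

-- The parts of x in the recursion of `D` count the odd and the even numbers below x, so they differ
-- by at most one; here the parts are arbitrary. Each of a and b is halved, and their halves are
-- paired so that the two sums are the two halves of a + b. The induction hypothesis then applies to
-- each pair.
D-superadditive : ∀ n a b → a ≤ b → b ≤ V n → D n a + D n b + (a + a) ≤ D (suc n) (a + b)
D-superadditive zero zero b a≤b _ = z≤n
D-superadditive zero (suc zero) (suc zero) _ _ = ≤-refl
D-superadditive zero (suc a) (suc (suc b)) _ (s≤s ())
D-superadditive zero (suc (suc a)) (suc zero) (s≤s ()) _
D-superadditive (suc n) a b a≤b b≤ with parity a | parity b
... | even p | even s = begin
  D (suc n) (p + p) + D (suc n) (s + s) + (p + p + (p + p))
    ≡⟨ cong₂ (λ x y → x + y + (p + p + (p + p))) (D-even n p) (D-even n s) ⟩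
  (D n p + D n p + (p + p)) + (D n s + D n s + (s + s)) + (p + p + (p + p))
    ≡⟨ eq (D n p) (D n s) p s ⟩
  (D n p + D n s + (p + p)) + (D n p + D n s + (p + p)) + ((p + s) + (p + s))
    ≤⟨ +-monoˡ-≤ _ (+-mono-≤ ih ih) ⟩
  D (suc n) (p + s) + D (suc n) (p + s) + ((p + s) + (p + s))
    ≡⟨ sym (D-even (suc n) (p + s)) ⟩
  D (suc (suc n)) ((p + s) + (p + s))
    ≡⟨ cong (D (suc (suc n))) (eq' p s) ⟩
  D (suc (suc n)) (p + p + (s + s)) ∎
  where
  open ≤-Reasoning
  ih : D n p + D n s + (p + p) ≤ D (suc n) (p + s)
  ih = D-superadditive n p s (half-≤ (m≤n⇒m≤1+n a≤b)) (half-≤ (m≤n⇒m≤1+n b≤))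
  eq : ∀ x y p s → (x + x + (p + p)) + (y + y + (s + s)) + (p + p + (p + p))
    ≡ (x + y + (p + p)) + (x + y + (p + p)) + ((p + s) + (p + s))
  eq = solve-∀
  eq' : ∀ p s → (p + s) + (p + s) ≡ p + p + (s + s)
  eq' = solve-∀
... | even p | odd s = begin
  D (suc n) (p + p) + D (suc n) (suc (s + s)) + (p + p + (p + p))
    ≡⟨ cong₂ (λ x y → x + y + (p + p + (p + p))) (D-even n p) (D-odd n s) ⟩
  (D n p + D n p + (p + p)) + (D n s + D n (suc s) + (s + s)) + (p + p + (p + p))
    ≡⟨ eq (D n p) (D n s) (D n (suc s)) p s ⟩
  (D n p + D n s + (p + p)) + (D n p + D n (suc s) + (p + p)) + ((p + s) + (p + s))
    ≤⟨ +-monoˡ-≤ _ (+-mono-≤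
         (D-superadditive n p s p≤s (≤-trans (n≤1+n s) s<))
         (D-superadditive n p (suc s) (m≤n⇒m≤1+n p≤s) s<)) ⟩
  D (suc n) (p + s) + D (suc n) (p + suc s) + ((p + s) + (p + s))
    ≡⟨ cong (λ z → D (suc n) (p + s) + D (suc n) z + ((p + s) + (p + s))) (+-suc p s) ⟩
  D (suc n) (p + s) + D (suc n) (suc (p + s)) + ((p + s) + (p + s))
    ≡⟨ sym (D-odd (suc n) (p + s)) ⟩
  D (suc (suc n)) (suc ((p + s) + (p + s)))
    ≡⟨ cong (D (suc (suc n))) (eq' p s) ⟩
  D (suc (suc n)) (p + p + suc (s + s)) ∎
  where
  open ≤-Reasoning
  p≤s : p ≤ s
  p≤s = half-≤ a≤b
  s< : s < V n
  s< = half-< b≤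
  eq : ∀ x y y' p s → (x + x + (p + p)) + (y + y' + (s + s)) + (p + p + (p + p))
    ≡ (x + y + (p + p)) + (x + y' + (p + p)) + ((p + s) + (p + s))
  eq = solve-∀
  eq' : ∀ p s → suc ((p + s) + (p + s)) ≡ p + p + suc (s + s)
  eq' = solve-∀
... | odd p | even s = begin
  D (suc n) (suc (p + p)) + D (suc n) (s + s) + (suc (p + p) + suc (p + p))
    ≡⟨ cong₂ (λ x y → x + y + (suc (p + p) + suc (p + p))) (D-odd n p) (D-even n s) ⟩
  (D n p + D n (suc p) + (p + p)) + (D n s + D n s + (s + s)) + (suc (p + p) + suc (p + p))
    ≡⟨ eq (D n p) (D n (suc p)) (D n s) p s ⟩
  (D n p + D n s + (p + p)) + (D n (suc p) + D n s + (suc p + suc p)) + ((p + s) + (p + s))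
    ≤⟨ +-monoˡ-≤ _ (+-mono-≤
         (D-superadditive n p s (<⇒≤ p<s) s≤)
         (D-superadditive n (suc p) s p<s s≤)) ⟩
  D (suc n) (p + s) + D (suc n) (suc (p + s)) + ((p + s) + (p + s))
    ≡⟨ sym (D-odd (suc n) (p + s)) ⟩
  D (suc (suc n)) (suc ((p + s) + (p + s)))
    ≡⟨ cong (D (suc (suc n))) (eq' p s) ⟩
  D (suc (suc n)) (suc (p + p) + (s + s)) ∎
  where
  open ≤-Reasoning
  p<s : p < s
  p<s = half-< a≤b
  s≤ : s ≤ V n
  s≤ = half-≤ (m≤n⇒m≤1+n b≤)
  eq : ∀ x x' y p s → (x + x' + (p + p)) + (y + y + (s + s)) + (suc (p + p) + suc (p + p))
    ≡ (x + y + (p + p)) + (x' + y + (suc p + suc p)) + ((p + s) + (p + s))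
  eq = solve-∀
  eq' : ∀ p s → suc ((p + s) + (p + s)) ≡ suc (p + p) + (s + s)
  eq' = solve-∀
... | odd p | odd s = begin
  D (suc n) (suc (p + p)) + D (suc n) (suc (s + s)) + (suc (p + p) + suc (p + p))
    ≡⟨ cong₂ (λ x y → x + y + (suc (p + p) + suc (p + p))) (D-odd n p) (D-odd n s) ⟩
  (D n p + D n (suc p) + (p + p)) + (D n s + D n (suc s) + (s + s)) + (suc (p + p) + suc (p + p))
    ≡⟨ eq (D n p) (D n (suc p)) (D n s) (D n (suc s)) p s ⟩
  (D n p + D n (suc s) + (p + p)) + (D n (suc p) + D n s + (p + p)) + ((suc p + s) + (suc p + s))
    ≤⟨ +-monoˡ-≤ _ (+-mono-≤
         (D-superadditive n p (suc s) (m≤n⇒m≤1+n p≤s) s<) other) ⟩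
  D (suc n) (p + suc s) + D (suc n) (suc p + s) + ((suc p + s) + (suc p + s))
    ≡⟨ cong (λ z → D (suc n) z + D (suc n) (suc p + s) + ((suc p + s) + (suc p + s))) (+-suc p s) ⟩
  D (suc n) (suc p + s) + D (suc n) (suc p + s) + ((suc p + s) + (suc p + s))
    ≡⟨ sym (D-even (suc n) (suc p + s)) ⟩
  D (suc (suc n)) ((suc p + s) + (suc p + s))
    ≡⟨ cong (D (suc (suc n))) (eq' p s) ⟩
  D (suc (suc n)) (suc (p + p) + suc (s + s)) ∎
  where
  open ≤-Reasoning
  p≤s : p ≤ s
  p≤s = half-≤ (m≤n⇒m≤1+n (≤-pred a≤b))
  s< : s < V n
  s< = half-< b≤
  -- For two odd parts, the smaller half of each is paired with the larger half of the other, so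
  -- that both sums are p + s + 1. If p = s, the half `suc p` is the larger one of its pair, and the
  -- induction hypothesis is used with the roles exchanged.
  other : D n (suc p) + D n s + (p + p) ≤ D (suc n) (suc p + s)
  other with m≤n⇒m<n∨m≡n p≤s
  ... | inj₁ p<s = ≤-trans (+-monoʳ-≤ (D n (suc p) + D n s) (+-mono-≤ (n≤1+n p) (n≤1+n p)))
                     (D-superadditive n (suc p) s p<s (<⇒≤ s<))
  ... | inj₂ refl = subst (_≤ D (suc n) (suc p + p)) (cong (_+ (p + p)) (+-comm (D n p) (D n (suc p))))
                     (subst (λ z → D n p + D n (suc p) + (p + p) ≤ D (suc n) z) (+-suc p p)
                       (D-superadditive n p (suc p) (n≤1+n p) s<))
  eq : ∀ x x' y y' p s → (x + x' + (p + p)) + (y + y' + (s + s)) + (suc (p + p) + suc (p + p))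
    ≡ (x + y' + (p + p)) + (x' + y + (p + p)) + ((suc p + s) + (suc p + s))
  eq = solve-∀
  eq' : ∀ p s → (suc p + s) + (suc p + s) ≡ suc (p + p) + suc (s + s)
  eq' = solve-∀

V≥1 : ∀ n → 1 ≤ V n
V≥1 zero = ≤-refl
V≥1 (suc n) = ≤-trans (V≥1 n) (m≤m+n _ _)

-- An initial segment of at most 2^r numbers lies in a subcube of dimension r, where no degree
-- exceeds r.
D≤r*x : ∀ n r x → x ≤ V r → D n x ≤ r * x
D≤r*x zero r x h = z≤n
D≤r*x (suc n) zero zero h = ≤-reflexive (D-0 (suc n))
D≤r*x (suc n) zero (suc zero) h = ≤-reflexive (D-1 (suc n))
D≤r*x (suc n) zero (suc (suc x)) (s≤s ())
D≤r*x (suc n) (suc r) x h with parity x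
... | even p = begin
  D (suc n) (p + p) ≡⟨ D-even n p ⟩
  D n p + D n p + (p + p) ≤⟨ +-monoˡ-≤ (p + p) (+-mono-≤ ih ih) ⟩
  r * p + r * p + (p + p) ≡⟨ eq r p ⟩
  suc r * (p + p) ∎
  where
  open ≤-Reasoning
  ih : D n p ≤ r * p
  ih = D≤r*x n r p (half-≤ (m≤n⇒m≤1+n h))
  eq : ∀ r p → r * p + r * p + (p + p) ≡ suc r * (p + p)
  eq = solve-∀
... | odd p = begin
  D (suc n) (suc (p + p)) ≡⟨ D-odd n p ⟩
  D n p + D n (suc p) + (p + p) ≤⟨ +-monoˡ-≤ (p + p) (+-mono-≤ (D≤r*x n r p (<⇒≤ (half-< h))) (D≤r*x n r (suc p) (half-< h))) ⟩
  r * p + r * suc p + (p + p) ≤⟨ n≤1+n _ ⟩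
  suc (r * p + r * suc p + (p + p)) ≡⟨ eq r p ⟩
  suc r * suc (p + p) ∎
  where
  open ≤-Reasoning
  eq : ∀ r p → suc (r * p + r * suc p + (p + p)) ≡ suc r * suc (p + p)
  eq = solve-∀

-- A full subcube attains r x, so the gain of r needs x < 2^r; for n ≥ r equality holds at x = 1 and
-- at x = 2^r - 1. In the induction an even x has a gain in both halves, an odd x only in the
-- smaller one, since the larger may fill its subcube.
D+r≤r*x : ∀ n r x → 1 ≤ x → x < V r → D n x + r ≤ r * x
D+r≤r*x zero r (suc x) _ h = ≤-trans (m≤m+n r (r * x)) (≤-reflexive (sym (*-suc r x)))
D+r≤r*x (suc n) zero (suc x) _ (s≤s ())
D+r≤r*x (suc n) (suc r) x 1≤x h with parity x
... | odd zero = ≤-reflexive (trans (cong (_+ suc r) (D-1 (suc n))) (sym (*-identityʳ (suc r))))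
... | odd (suc p) = begin
  D (suc n) (suc (q + q)) + suc r ≡⟨ cong (_+ suc r) (D-odd n q) ⟩
  D n q + D n (suc q) + (q + q) + suc r ≡⟨ eq₁ (D n q) (D n (suc q)) q r ⟩
  (D n q + r) + D n (suc q) + suc (q + q)
    ≤⟨ +-monoˡ-≤ _ (+-mono-≤ (D+r≤r*x n r q (s≤s z≤n) q<) (D≤r*x n r (suc q) q<)) ⟩
  r * q + r * suc q + suc (q + q) ≡⟨ eq₂ r q ⟩
  suc r * suc (q + q) ∎
  where
  open ≤-Reasoning
  q = suc p
  q< : q < V r
  q< = half-< (<-trans (n<1+n _) h)
  eq₁ : ∀ x y q r → x + y + (q + q) + suc r ≡ (x + r) + y + suc (q + q)
  eq₁ = solve-∀
  eq₂ : ∀ r q → r * q + r * suc q + suc (q + q) ≡ suc r * suc (q + q)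
  eq₂ = solve-∀
-- Two gains of r have to cover the required r + 1, which fails only for r = 0; but then x < 2 while
-- x is even and positive.
... | even (suc p) with r
... | zero = contradiction (half-< {suc p} {1} h) (λ { (s≤s ()) })
... | suc r' = begin
  D (suc n) (q + q) + suc (suc r') ≡⟨ cong (_+ suc (suc r')) (D-even n q) ⟩
  D n q + D n q + (q + q) + suc (suc r') ≤⟨ +-monoʳ-≤ (D n q + D n q + (q + q)) (s≤s (s≤s (m≤m+n r' r'))) ⟩
  D n q + D n q + (q + q) + suc (suc (r' + r')) ≡⟨ eq₁ (D n q) q r' ⟩
  (D n q + suc r') + (D n q + suc r') + (q + q) ≤⟨ +-monoˡ-≤ (q + q) (+-mono-≤ ih ih) ⟩
  suc r' * q + suc r' * q + (q + q) ≡⟨ eq₂ (suc r') q ⟩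
  suc (suc r') * (q + q) ∎
  where
  open ≤-Reasoning
  q = suc p
  ih : D n q + suc r' ≤ suc r' * q
  ih = D+r≤r*x n (suc r') q (s≤s z≤n) (half-< h)
  eq₁ : ∀ x q r → x + x + (q + q) + suc (suc (r + r)) ≡ (x + suc r) + (x + suc r) + (q + q)
  eq₁ = solve-∀
  eq₂ : ∀ r p → r * p + r * p + (p + p) ≡ suc r * (p + p)
  eq₂ = solve-∀

-- In dimension m = 1 + r + t this says that the boundary m x - D x of x vertices
-- is at least 2 ^ r (m - r), as long as x is at most half of 2 ^ m.
D-middle : ∀ n r t x → V r ≤ x → x ≤ V (r + t) → D n x + V r * suc t ≤ suc (r + t) * x
-- For r = 0 the claim is that the boundary has at least m = 1 + t edges, which is the previous
-- bound taken in dimension m.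
D-middle n zero t x h₁ h₂ = subst (λ z → D n x + z ≤ suc t * x) (sym (+-identityʳ (suc t)))
  (D+r≤r*x n (suc t) x h₁ (≤-<-trans h₂ (m<m+n (V t) (V≥1 t))))
D-middle zero (suc r) t x h₁ h₂ = begin
  V (suc r) * suc t ≤⟨ *-mono-≤ h₁ (s≤s (m≤n+m t (suc r))) ⟩
  x * suc (suc r + t) ≡⟨ *-comm x _ ⟩
  suc (suc r + t) * x ∎
  where open ≤-Reasoning
-- Halving x lowers r and the dimension together, so `t` stays fixed while both ends of the range of
-- x are halved.
D-middle (suc n) (suc r) t x h₁ h₂ with parity x
... | even p = begin
  D (suc n) (p + p) + V (suc r) * suc t ≡⟨ cong (_+ V (suc r) * suc t) (D-even n p) ⟩
  D n p + D n p + (p + p) + (V r + V r) * suc t ≡⟨ eq₁ (D n p) p (V r) t ⟩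
  (D n p + V r * suc t) + (D n p + V r * suc t) + (p + p) ≤⟨ +-monoˡ-≤ (p + p) (+-mono-≤ ih ih) ⟩
  suc (r + t) * p + suc (r + t) * p + (p + p) ≡⟨ eq₂ (r + t) p ⟩
  suc (suc r + t) * (p + p) ∎
  where
  open ≤-Reasoning
  ih : D n p + V r * suc t ≤ suc (r + t) * p
  ih = D-middle n r t p (half-≤ (m≤n⇒m≤1+n h₁)) (half-≤ (m≤n⇒m≤1+n h₂))
  eq₁ : ∀ x p v t → x + x + (p + p) + (v + v) * suc t ≡ (x + v * suc t) + (x + v * suc t) + (p + p)
  eq₁ = solve-∀
  eq₂ : ∀ s p → suc s * p + suc s * p + (p + p) ≡ suc (suc s) * (p + p)
  eq₂ = solve-∀
... | odd p = begin
  D (suc n) (suc (p + p)) + V (suc r) * suc t ≡⟨ cong (_+ V (suc r) * suc t) (D-odd n p) ⟩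
  D n p + D n (suc p) + (p + p) + (V r + V r) * suc t ≡⟨ eq₁ (D n p) (D n (suc p)) p (V r) t ⟩
  (D n p + V r * suc t) + (D n (suc p) + V r * suc t) + (p + p)
    ≤⟨ +-mono-≤ (+-mono-≤ (D-middle n r t p p≥ (<⇒≤ p<)) (D-middle n r t (suc p) (m≤n⇒m≤1+n p≥) p<)) (n≤1+n (p + p)) ⟩
  suc (r + t) * p + suc (r + t) * suc p + suc (p + p) ≡⟨ eq₂ (r + t) p ⟩
  suc (suc r + t) * suc (p + p) ∎
  where
  open ≤-Reasoning
  p≥ : V r ≤ p
  p≥ = half-≤ h₁
  p< : p < V (r + t)
  p< = half-< h₂
  eq₁ : ∀ x y p v t → x + y + (p + p) + (v + v) * suc t ≡ (x + v * suc t) + (y + v * suc t) + (p + p)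
  eq₁ = solve-∀
  eq₂ : ∀ s p → suc s * p + suc s * suc p + suc (p + p) ≡ suc (suc s) * suc (p + p)
  eq₂ = solve-∀

-- Edge cuts

-- All three count ordered pairs: an edge inside X occurs twice in `inner`, a boundary edge once in
-- `cut`. Symmetry is not built in, so the same functions serve for directed flows.
cut inner vol : ∀ {N} → Adj N → VSet N → ℕ
cut G X = card₂ (λ i j → X i ∧ (not (X j) ∧ G i j))
inner G X = card₂ (λ i j → X i ∧ (X j ∧ G i j))
vol G X = card₂ (λ i j → X i ∧ G i j)

Symm : ∀ {N} → Adj N → Set
Symm G = ∀ i j → G i j ≡ G j i

vol≡inner+cut : ∀ {N} (G : Adj N) X → vol G X ≡ inner G X + cut G X
vol≡inner+cut G X = card₂-cong-+ λ i j → lem (X i) (X j) (G i j)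
  where
  lem : ∀ a b c → ind (a ∧ c) ≡ ind (a ∧ (b ∧ c)) + ind (a ∧ (not b ∧ c))
  lem false b c = refl
  lem true true c = sym (+-identityʳ _)
  lem true false c = refl

inner-flip : ∀ {N} (G : Adj N) X → inner (flip G) X ≡ inner G X
inner-flip G X = trans (card₂-swap (λ i j → X i ∧ (X j ∧ G j i))) (card₂-cong λ i j → lem (X i) (X j) (G i j))
  where
  lem : ∀ a b c → b ∧ (a ∧ c) ≡ a ∧ (b ∧ c)
  lem true b c = refl
  lem false true c = refl
  lem false false c = refl

cut-complement : ∀ {N} (G : Adj N) X → Symm G → cut G (not ∘ X) ≡ cut G X
cut-complement G X Gs = trans (card₂-swap (λ i j → not (X i) ∧ (not (not (X j)) ∧ G i j)))
  (card₂-cong λ i j → trans (lem (X i) (X j) (G j i)) (cong (λ z → X i ∧ (not (X j) ∧ z)) (Gs j i)))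
  where
  lem : ∀ a b c → not b ∧ (not (not a) ∧ c) ≡ a ∧ (not b ∧ c)
  lem true true c = refl
  lem true false c = refl
  lem false true c = refl
  lem false false c = refl

-- The edge version of Menger's theorem

IsClosed : ∀ {N} → Adj N → VSet N → Set
IsClosed H X = ∀ i j → X i ≡ true → X j ≡ false → H i j ≡ false

PathOrClosed : ∀ {N} → Adj N → Fin N → Fin N → Set
PathOrClosed {N} H u v = Σ (Walk H u v) IsPath ⊎
  Σ (VSet N) λ X → X u ≡ true × X v ≡ false × IsClosed H X

not-false : ∀ {a} → a ≡ false → not a ≡ true
not-false refl = refl

not-not-true : ∀ {a} → not a ≡ false → a ≡ true
not-not-true {true} _ = refl

-- A search backwards from v, the direction in which walks are extended by a cons. The set Y
-- consists of vertices known to reach v by a path inside Y. When no edge enters Y any more, either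
-- u is in Y or the complement of Y is the closed set.
path-or-closed : ∀ {N} (H : Adj N) u v → PathOrClosed H u v
path-or-closed {N} H u v = grow N (λ i → ⌊ v ≟ i ⌋)
  (≤-trans (m≤n+m _ _) (≤-reflexive (#-complement (λ i → ⌊ v ≟ i ⌋)))) (⌊≟⌋-refl v)
  λ x h → subst (Reaches _) (⌊≟⌋-sound h) ([] , ([] ∷ []) , (⌊≟⌋-refl v ∷ []))
  where
  Reaches : VSet N → Fin N → Set
  Reaches Y x = Σ (Walk H x v) λ p → IsPath p × All (λ y → Y y ≡ true) (vertices p)

  grow : ∀ k (Y : VSet N) → # (not ∘ Y) ≤ k → Y v ≡ true → (∀ x → Y x ≡ true → Reaches Y x) →
    PathOrClosed H u v
  grow k Y small Yv reach
    with any? (λ i → any? (λ j → (Y i ≟ᵇ false) ×-dec ((Y j ≟ᵇ true) ×-dec (H i j ≟ᵇ true))))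
  ... | no none with Y u in Yu
  ...   | true = let p , isPath , _ = reach u Yu in inj₁ (p , isPath)
  ...   | false = inj₂ (not ∘ Y , not-false Yu , cong not Yv ,
            λ i j Yi Yj → ¬-not λ Hij → none (i , j , not-true Yi , not-not-true Yj , Hij))
  grow zero Y small Yv reach | yes (i , j , Yi , Yj , Hij) =
    contradiction (≤-trans (member⇒1≤# (not ∘ Y) i (not-false Yi)) small) λ ()
  grow (suc k) Y small Yv reach | yes (i , j , Yi , Yj , Hij) =
    grow k Y' (≤-pred (≤-trans shrink small)) (Y⊆Y' Yv) reach'
    where
    Y' : VSet N
    Y' x = Y x ∨ ⌊ i ≟ x ⌋

    Y⊆Y' : ∀ {x} → Y x ≡ true → Y' x ≡ true
    Y⊆Y' h rewrite h = refl

    i∈Y' : Y' i ≡ true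
    i∈Y' rewrite Yi = ⌊≟⌋-refl i

    Y'-split : ∀ x → Y' x ≡ true → Y x ≡ true ⊎ i ≡ x
    Y'-split x h with Y x
    ... | true = inj₁ refl
    ... | false = inj₂ (⌊≟⌋-sound h)

    weaken : ∀ {xs} → All (λ y → Y y ≡ true) xs → All (λ y → Y' y ≡ true) xs
    weaken = All.map Y⊆Y'

    new : Reaches Y' i
    new with reach j Yj
    -- The vertex i lies outside Y and the path from j stays inside Y, so prepending i repeats no
    -- vertex.
    ... | p , isPath , inY = (Hij ∷ p) ,
      (All.map (λ Yy i≡y → true≢false Yy (trans (cong Y (sym i≡y)) Yi)) inY ∷ isPath) ,
      (i∈Y' ∷ weaken inY)

    reach' : ∀ x → Y' x ≡ true → Reaches Y' x
    reach' x h with Y'-split x h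
    ... | inj₁ Yx = let p , isPath , inY = reach x Yx in p , isPath , weaken inY
    ... | inj₂ i≡x = subst (Reaches Y') i≡x new

    pointwise : ∀ a b → (b ≡ true → a ≡ false) → ind b + ind (not (a ∨ b)) ≤ ind (not a)
    pointwise true true h with () ← h refl
    pointwise true false h = z≤n
    pointwise false true h = ≤-refl
    pointwise false false h = ≤-refl

    shrink : suc (# (not ∘ Y')) ≤ # (not ∘ Y)
    shrink = begin
      suc (# (not ∘ Y')) ≡⟨ cong (_+ # (not ∘ Y')) (sym (#-singleton i)) ⟩
      # (λ x → ⌊ i ≟ x ⌋) + # (not ∘ Y') ≡⟨ sym (∑-distrib-+ (λ x → ind ⌊ i ≟ x ⌋) (λ x → ind (not (Y' x)))) ⟩
      sum (λ x → ind ⌊ i ≟ x ⌋ + ind (not (Y' x)))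
        ≤⟨ sum-mono (λ x → pointwise (Y x) ⌊ i ≟ x ⌋ λ h → trans (cong Y (sym (⌊≟⌋-sound h))) Yi) ⟩
      # (not ∘ Y) ∎
      where open ≤-Reasoning

-- Walks as sets of directed edges

onWalk : ∀ {N} {G : Adj N} {u v} → Walk G u v → Adj N
onWalk [] i j = false
onWalk (_∷_ {u} {w} e p) i j = (⌊ u ≟ i ⌋ ∧ ⌊ w ≟ j ⌋) ∨ onWalk p i j

module _ {N} {G : Adj N} where

  source∈vertices : ∀ {u v} (p : Walk G u v) → u ∈ vertices p
  source∈vertices [] = here refl
  source∈vertices (_ ∷ p) = here refl

  onWalk-cases : ∀ {u w v} (e : G u w ≡ true) (p : Walk G w v) {i j} → onWalk (e ∷ p) i j ≡ true →
    (u ≡ i × w ≡ j) ⊎ onWalk p i j ≡ true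
  onWalk-cases {u} {w} e p {i} {j} h with ⌊ u ≟ i ⌋ ∧ ⌊ w ≟ j ⌋ in eq
  ... | true = inj₁ (⌊≟⌋-sound (∧-left eq) , ⌊≟⌋-sound (∧-right {⌊ u ≟ i ⌋} eq))
  ... | false = inj₂ h

  onWalk⇒edge : ∀ {u v} (p : Walk G u v) {i j} → onWalk p i j ≡ true → G i j ≡ true
  onWalk⇒edge (e ∷ p) h with onWalk-cases e p h
  ... | inj₁ (refl , refl) = e
  ... | inj₂ h' = onWalk⇒edge p h'

  onWalk⇒∈ˡ : ∀ {u v} (p : Walk G u v) {i j} → onWalk p i j ≡ true → i ∈ vertices p
  onWalk⇒∈ˡ (e ∷ p) h with onWalk-cases e p h
  ... | inj₁ (refl , _) = here refl
  ... | inj₂ h' = there (onWalk⇒∈ˡ p h')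

  onWalk⇒∈ʳ : ∀ {u v} (p : Walk G u v) {i j} → onWalk p i j ≡ true → j ∈ vertices p
  onWalk⇒∈ʳ (e ∷ p) h with onWalk-cases e p h
  ... | inj₁ (_ , refl) = there (source∈vertices p)
  ... | inj₂ h' = there (onWalk⇒∈ʳ p h')

  ∈edges⇒onWalk : ∀ {u v} (p : Walk G u v) {i j} → (i , j) ∈ edges p → onWalk p i j ≡ true
  ∈edges⇒onWalk (_∷_ {u} {w} e p) (here refl) rewrite ⌊≟⌋-refl u | ⌊≟⌋-refl w = refl
  ∈edges⇒onWalk (_∷_ {u} {w} e p) {i} {j} (there h) with ⌊ u ≟ i ⌋ ∧ ⌊ w ≟ j ⌋
  ... | true = refl
  ... | false = ∈edges⇒onWalk p h

  onWalk-antisym : ∀ {u v} (p : Walk G u v) → IsPath p → ∀ {i j} →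
    onWalk p i j ≡ true → onWalk p j i ≡ true → ⊥
  onWalk-antisym (e ∷ p) (u∉ ∷ isPath) h₁ h₂ with onWalk-cases e p h₁ | onWalk-cases e p h₂
  ... | inj₁ (refl , refl) | inj₁ (refl , _) = All¬⇒¬Any u∉ (source∈vertices p)
  ... | inj₁ (refl , refl) | inj₂ h₂' = All¬⇒¬Any u∉ (onWalk⇒∈ʳ p h₂')
  ... | inj₂ h₁' | inj₁ (refl , refl) = All¬⇒¬Any u∉ (onWalk⇒∈ʳ p h₁')
  ... | inj₂ h₁' | inj₂ h₂' = onWalk-antisym p isPath h₁' h₂'

  private
    disjoint-∨ : ∀ a b → (a ≡ true → b ≡ true → ⊥) → ind (a ∨ b) ≡ ind a + ind b
    disjoint-∨ true true h = ⊥-elim (h refl refl)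
    disjoint-∨ true false h = refl
    disjoint-∨ false b h = refl

    #-∧ʳ : ∀ (w : Fin N) a → # (λ j → ⌊ w ≟ j ⌋ ∧ a) ≡ ind a
    #-∧ʳ w true = trans (#-cong {f = λ j → ⌊ w ≟ j ⌋ ∧ true} λ j → ∧-identityʳ ⌊ w ≟ j ⌋) (#-singleton w)
    #-∧ʳ w false = #-empty {f = λ j → ⌊ w ≟ j ⌋ ∧ false} λ j → ∧-zeroʳ ⌊ w ≟ j ⌋

  -- Each passage through a vertex enters and leaves it once, so only the two ends are unbalanced.
  -- The end terms are placed on opposite sides to avoid subtraction.
  onWalk-balance : ∀ {u v} (p : Walk G u v) → IsPath p → ∀ i →
    # (onWalk p i) + ind ⌊ v ≟ i ⌋ ≡ # (flip (onWalk p) i) + ind ⌊ u ≟ i ⌋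
  onWalk-balance [] _ i = refl
  onWalk-balance {u} {v} (_∷_ {w = w} e p) (u∉ ∷ isPath) i = begin
    # (onWalk (e ∷ p) i) + ind ⌊ v ≟ i ⌋ ≡⟨ cong (_+ ind ⌊ v ≟ i ⌋) row ⟩
    (ind ⌊ u ≟ i ⌋ + # (onWalk p i)) + ind ⌊ v ≟ i ⌋ ≡⟨ +-assoc (ind ⌊ u ≟ i ⌋) _ _ ⟩
    ind ⌊ u ≟ i ⌋ + (# (onWalk p i) + ind ⌊ v ≟ i ⌋) ≡⟨ cong (ind ⌊ u ≟ i ⌋ +_) (onWalk-balance p isPath i) ⟩
    ind ⌊ u ≟ i ⌋ + (# (flip (onWalk p) i) + ind ⌊ w ≟ i ⌋) ≡⟨ lem (ind ⌊ u ≟ i ⌋) (# (flip (onWalk p) i)) (ind ⌊ w ≟ i ⌋) ⟩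
    (ind ⌊ w ≟ i ⌋ + # (flip (onWalk p) i)) + ind ⌊ u ≟ i ⌋ ≡⟨ cong (_+ ind ⌊ u ≟ i ⌋) (sym col) ⟩
    # (flip (onWalk (e ∷ p)) i) + ind ⌊ u ≟ i ⌋ ∎
    where
    open ≡-Reasoning
    lem : ∀ a b c → a + (b + c) ≡ (c + b) + a
    lem = solve-∀
    -- A path never returns to u, so its first arc does not recur later and the disjunction in
    -- `onWalk` counts as a sum.
    first : ∀ i j → ind (onWalk (e ∷ p) i j) ≡ ind (⌊ u ≟ i ⌋ ∧ ⌊ w ≟ j ⌋) + ind (onWalk p i j)
    first i j = disjoint-∨ (⌊ u ≟ i ⌋ ∧ ⌊ w ≟ j ⌋) (onWalk p i j) λ h₁ h₂ →
      All¬⇒¬Any u∉ (subst (_∈ vertices p) (sym (⌊≟⌋-sound (∧-left h₁))) (onWalk⇒∈ˡ p h₂))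
    row : # (onWalk (e ∷ p) i) ≡ ind ⌊ u ≟ i ⌋ + # (onWalk p i)
    row = trans (sum-cong-+ (first i)) (cong (_+ # (onWalk p i)) (#-∧ˡ ⌊ u ≟ i ⌋ w))
    col : # (flip (onWalk (e ∷ p)) i) ≡ ind ⌊ w ≟ i ⌋ + # (flip (onWalk p) i)
    col = trans (sum-cong-+ (λ j → first j i)) (cong (_+ # (flip (onWalk p) i)) (#-∧ʳ u ⌊ w ≟ i ⌋))

  onWalk-balance-≢target : ∀ {u v} (p : Walk G u v) → IsPath p → ∀ i → i ≢ v →
    # (onWalk p i) ≡ # (flip (onWalk p) i) + ind ⌊ u ≟ i ⌋
  onWalk-balance-≢target p isPath i i≢v = trans (sym (+-identityʳ _))
    (trans (cong (λ b → # (onWalk p i) + ind b) (sym (⌊≟⌋-≢ (i≢v ∘ sym)))) (onWalk-balance p isPath i))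

  module _ {H : Adj N} (H⊆G : ∀ i j → H i j ≡ true → G i j ≡ true) where

    embed : ∀ {u v} → Walk H u v → Walk G u v
    embed [] = []
    embed (e ∷ p) = H⊆G _ _ e ∷ embed p

    embed-vertices : ∀ {u v} (p : Walk H u v) → vertices (embed p) ≡ vertices p
    embed-vertices [] = refl
    embed-vertices {u} (_ ∷ p) = cong (u Data.List.∷_) (embed-vertices p)

    embed-edges : ∀ {u v} (p : Walk H u v) → edges (embed p) ≡ edges p
    embed-edges [] = refl
    embed-edges {u} (_∷_ {w = w} _ p) = cong ((u , w) Data.List.∷_) (embed-edges p)

-- A 0/1 flow of value k: `antisym` lets every edge carry flow in at most one direction, and
-- `balance` gives u a surplus of k and conserves flow everywhere else except at the sink v.
record Flow {N} (G : Adj N) (u v : Fin N) (k : ℕ) : Set where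
  field
    flow : Adj N
    flow⊆ : ∀ i j → flow i j ≡ true → G i j ≡ true
    antisym : ∀ i j → flow i j ≡ true → flow j i ≡ true → ⊥
    balance : ∀ i → i ≢ v → # (flow i) ≡ # (flip flow i) + k * ind ⌊ u ≟ i ⌋

module _ {N} {G : Adj N} {u v : Fin N} where

  open Flow

  -- When `balance` is summed over X, the arcs inside X cancel, because reversing all arcs leaves
  -- `inner` unchanged.
  flow-across : ∀ {k} (f : Flow G u v k) X → X u ≡ true → X v ≡ false →
    cut (flow f) X ≡ cut (flip (flow f)) X + k
  flow-across {k} f X Xu Xv = +-cancelˡ-≡ (inner (flow f) X) _ _ (begin
    inner (flow f) X + cut (flow f) X ≡⟨ sym (vol≡inner+cut (flow f) X) ⟩
    vol (flow f) X ≡⟨ sum-cong-+ row ⟩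
    vol (flip (flow f)) X + sum (λ i → k * ind ⌊ u ≟ i ⌋)
      ≡⟨ cong₂ _+_ (vol≡inner+cut (flip (flow f)) X) source ⟩
    inner (flip (flow f)) X + cut (flip (flow f)) X + k
      ≡⟨ cong (λ z → z + cut (flip (flow f)) X + k) (inner-flip (flow f) X) ⟩
    inner (flow f) X + cut (flip (flow f)) X + k ≡⟨ +-assoc (inner (flow f) X) _ _ ⟩
    inner (flow f) X + (cut (flip (flow f)) X + k) ∎)
    where
    open ≡-Reasoning
    source : sum (λ i → k * ind ⌊ u ≟ i ⌋) ≡ k
    source = trans (sym (*-distribˡ-sum k (λ i → ind ⌊ u ≟ i ⌋)))
      (trans (cong (k *_) (#-singleton u)) (*-identityʳ k))
    row : ∀ i → # (λ j → X i ∧ flow f i j) ≡ # (λ j → X i ∧ flow f j i) + k * ind ⌊ u ≟ i ⌋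
    row i with X i in Xi
    ... | true = balance f i λ i≡v → true≢false Xi (trans (cong X i≡v) Xv)
    ... | false = sym (trans (cong (# {N} (λ _ → false) +_)
            (trans (cong (λ b → k * ind b) (⌊≟⌋-≢ λ u≡i → true≢false Xu (trans (cong X u≡i) Xi))) (*-zeroʳ k)))
            (+-identityʳ _))

  flow-through-closed : ∀ {k} (f : Flow G u v k) X → X u ≡ true → X v ≡ false → IsClosed (flow f) X → k ≡ 0
  flow-through-closed {k} f X Xu Xv closed = m+n≡0⇒n≡0 (cut (flip (flow f)) X)
    (trans (sym (flow-across f X Xu Xv)) (trans (sum-cong-≗ {N} λ i → #-empty {f = λ j → X i ∧ (not (X j) ∧ flow f i j)} λ j → none i j) (sum-zero N)))
    where
    none : ∀ i j → X i ∧ (not (X j) ∧ flow f i j) ≡ false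
    none i j with X i in Xi | X j in Xj
    ... | false | _ = refl
    ... | true | true = refl
    ... | true | false = closed i j Xi Xj

  removePath : ∀ {k} (f : Flow G u v (suc k)) (p : Walk (flow f) u v) → IsPath p → Flow G u v k
  removePath {k} f p isPath = record
    { flow = λ i j → flow f i j ∧ not (onWalk p i j)
    ; flow⊆ = λ i j h → flow⊆ f i j (∧-left h)
    ; antisym = λ i j h₁ h₂ → antisym f i j (∧-left h₁) (∧-left h₂)
    ; balance = λ i i≢v → +-cancelʳ-≡ (# (flip P i) + ind ⌊ u ≟ i ⌋) _ _ (begin
        # (λ j → flow f i j ∧ not (P i j)) + (# (flip P i) + ind ⌊ u ≟ i ⌋)
          ≡⟨ cong (# (λ j → flow f i j ∧ not (P i j)) +_) (sym (onWalk-balance-≢target p isPath i i≢v)) ⟩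
        # (λ j → flow f i j ∧ not (P i j)) + # (P i)
          ≡⟨ sym (sum-cong-+ (λ j → lem (flow f i j) (P i j) (onWalk⇒edge p))) ⟩
        # (flow f i)
          ≡⟨ balance f i i≢v ⟩
        # (flip (flow f) i) + suc k * ind ⌊ u ≟ i ⌋
          ≡⟨ cong (_+ suc k * ind ⌊ u ≟ i ⌋) (sum-cong-+ (λ j → lem (flow f j i) (P j i) (onWalk⇒edge p))) ⟩
        # (λ j → flow f j i ∧ not (P j i)) + # (flip P i) + suc k * ind ⌊ u ≟ i ⌋
          ≡⟨ rearrange (# (λ j → flow f j i ∧ not (P j i))) (# (flip P i)) (ind ⌊ u ≟ i ⌋) k ⟩
        # (λ j → flow f j i ∧ not (P j i)) + k * ind ⌊ u ≟ i ⌋ + (# (flip P i) + ind ⌊ u ≟ i ⌋) ∎)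
    }
    where
    open ≡-Reasoning
    P = onWalk p
    lem : ∀ a b → (b ≡ true → a ≡ true) → ind a ≡ ind (a ∧ not b) + ind b
    lem true true h = refl
    lem true false h = refl
    lem false true h with () ← h refl
    lem false false h = refl
    rearrange : ∀ a b d k → a + b + suc k * d ≡ a + k * d + (b + d)
    rearrange = solve-∀

  -- The last component carries the induction: later paths use only arcs that remain after an
  -- earlier path is removed, so they avoid its arcs, and antisymmetry of the flow rules out the
  -- reversed arcs.
  DisjointPaths : Adj N → ℕ → Set
  DisjointPaths H k = Σ (Fin k → Walk G u v) λ ps →
    (∀ i → IsPath (ps i)) × (∀ i j → i ≢ j → EdgeDisjoint (ps i) (ps j)) ×
    (∀ i a b → (a , b) ∈ edges (ps i) → H a b ≡ true)

  -- A flow of positive value leaves every set that separates u from v, so some path runs along its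
  -- arcs; removing it lowers the value by one.
  flow⇒paths : ∀ k (f : Flow G u v k) → DisjointPaths (flow f) k
  flow⇒paths zero f = (λ ()) , (λ ()) , (λ ()) , λ ()
  flow⇒paths (suc k) f with path-or-closed (flow f) u v
  ... | inj₂ (X , Xu , Xv , closed) with () ← flow-through-closed f X Xu Xv closed
  ... | inj₁ (p , isPath) with flow⇒paths k (removePath f p isPath)
  ... | ps , ps-path , ps-disjoint , ps⊆ = qs , qs-path , qs-disjoint , qs⊆
    where
    q : Walk G u v
    q = embed (flow⊆ f) p
    q⇒onWalk : ∀ {a b} → (a , b) ∈ edges q → onWalk p a b ≡ true
    q⇒onWalk h = ∈edges⇒onWalk p (subst (_ ∈_) (embed-edges (flow⊆ f) p) h)
    qs : Fin (suc k) → Walk G u v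
    qs zero = q
    qs (suc i) = ps i
    qs-path : ∀ i → IsPath (qs i)
    qs-path zero = subst Unique (sym (embed-vertices (flow⊆ f) p)) isPath
    qs-path (suc i) = ps-path i
    apart : ∀ i {a b} → (a , b) ∈ edges q → (a , b) ∈ edges (ps i) ⊎ (b , a) ∈ edges (ps i) → ⊥
    apart i h (inj₁ h') = true≢false (q⇒onWalk h) (not-true (∧-right {flow f _ _} (ps⊆ i _ _ h')))
    apart i h (inj₂ h') = antisym f _ _ (onWalk⇒edge p (q⇒onWalk h)) (∧-left (ps⊆ i _ _ h'))
    qs-disjoint : ∀ i j → i ≢ j → EdgeDisjoint (qs i) (qs j)
    qs-disjoint zero zero i≢j = contradiction refl i≢j
    qs-disjoint zero (suc j) _ a b h = apart j h
    qs-disjoint (suc i) zero _ a b h (inj₁ h') = apart i h' (inj₁ h)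
    qs-disjoint (suc i) zero _ a b h (inj₂ h') = apart i h' (inj₂ h)
    qs-disjoint (suc i) (suc j) i≢j = ps-disjoint i j (i≢j ∘ cong suc)
    qs⊆ : ∀ i a b → (a , b) ∈ edges (qs i) → flow f a b ≡ true
    qs⊆ zero a b h = onWalk⇒edge p (q⇒onWalk h)
    qs⊆ (suc i) a b h = ∧-left (ps⊆ i a b h)

  -- When G is symmetric, the reverse of a flow arc remains available; traversing it cancels that
  -- arc.
  residual : ∀ {k} → Flow G u v k → Adj N
  residual f i j = G i j ∧ not (flow f i j)

  -- On every pair i, j the net flow of `g` is the sum of the net flows of f and of the path,
  -- opposite arcs having cancelled. `exchange` is this identity without subtraction, and summing it
  -- over j gives the new balance.
  augment : ∀ {k} (f : Flow G u v k) (p : Walk (residual f) u v) → IsPath p → Flow G u v (suc k)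
  augment {k} f p isPath = record
    { flow = g
    ; flow⊆ = λ i j h → [ (λ h' → flow⊆ f i j (∧-left h')) , (λ h' → ∧-left (onWalk⇒edge p (∧-left h'))) ]′ (∨-cases (flow f i j ∧ not (P j i)) h)
    ; antisym = λ i j → g-antisym (flow f i j) (flow f j i) (P i j) (P j i)
        (antisym f i j) (onWalk-antisym p isPath) (P⇒¬f i j) (P⇒¬f j i)
    ; balance = λ i i≢v → +-cancelʳ-≡ (# (flip (flow f) i) + # (flip P i)) _ _ (begin
        # (g i) + (# (flip (flow f) i) + # (flip P i))
          ≡⟨ cong (# (g i) +_) (sym (∑-distrib-+ (λ j → ind (flow f j i)) (λ j → ind (P j i)))) ⟩
        # (g i) + sum (λ j → ind (flow f j i) + ind (P j i))
          ≡⟨ sym (∑-distrib-+ (λ j → ind (g i j)) _) ⟩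
        sum (λ j → ind (g i j) + (ind (flow f j i) + ind (P j i)))
          ≡⟨ sum-cong-≗ (λ j → exchange (flow f i j) (flow f j i) (P i j) (P j i)
               (antisym f i j) (onWalk-antisym p isPath) (P⇒¬f i j) (P⇒¬f j i)) ⟩
        sum (λ j → ind (g j i) + (ind (flow f i j) + ind (P i j)))
          ≡⟨ ∑-distrib-+ (λ j → ind (g j i)) _ ⟩
        # (flip g i) + sum (λ j → ind (flow f i j) + ind (P i j))
          ≡⟨ cong (# (flip g i) +_) (∑-distrib-+ (λ j → ind (flow f i j)) (λ j → ind (P i j))) ⟩
        # (flip g i) + (# (flow f i) + # (P i))
          ≡⟨ cong (# (flip g i) +_) (cong₂ _+_ (balance f i i≢v) (onWalk-balance-≢target p isPath i i≢v)) ⟩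
        # (flip g i) + ((# (flip (flow f) i) + k * ind ⌊ u ≟ i ⌋) + (# (flip P i) + ind ⌊ u ≟ i ⌋))
          ≡⟨ rearrange (# (flip g i)) (# (flip (flow f) i)) k (ind ⌊ u ≟ i ⌋) (# (flip P i)) ⟩
        # (flip g i) + suc k * ind ⌊ u ≟ i ⌋ + (# (flip (flow f) i) + # (flip P i)) ∎)
    }
    where
    open ≡-Reasoning
    P = onWalk p
    g : Adj N
    g i j = (flow f i j ∧ not (P j i)) ∨ (P i j ∧ not (flow f j i))
    ∨-cases : ∀ a {b} → a ∨ b ≡ true → a ≡ true ⊎ b ≡ true
    ∨-cases true h = inj₁ refl
    ∨-cases false h = inj₂ h
    P⇒¬f : ∀ i j → P i j ≡ true → flow f i j ≡ true → ⊥
    P⇒¬f i j h h' = true≢false h' (not-true (∧-right {G i j} (onWalk⇒edge p h)))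
    rearrange : ∀ x a k d b → x + ((a + k * d) + (b + d)) ≡ x + suc k * d + (a + b)
    rearrange = solve-∀
    NotBoth : Bool → Bool → Set
    NotBoth a b = a ≡ true → b ≡ true → ⊥
    g-antisym : ∀ a a' b b' → NotBoth a a' → NotBoth b b' → NotBoth b a → NotBoth b' a' →
      NotBoth ((a ∧ not b') ∨ (b ∧ not a')) ((a' ∧ not b) ∨ (b' ∧ not a))
    g-antisym true true b b' h₁ h₂ h₃ h₄ = ⊥-elim (h₁ refl refl)
    g-antisym true false true b' h₁ h₂ h₃ h₄ = ⊥-elim (h₃ refl refl)
    g-antisym true false false true h₁ h₂ h₃ h₄ ()
    g-antisym true false false false h₁ h₂ h₃ h₄ _ ()
    g-antisym false true b true h₁ h₂ h₃ h₄ = ⊥-elim (h₄ refl refl)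
    g-antisym false true true false h₁ h₂ h₃ h₄ ()
    g-antisym false true false false h₁ h₂ h₃ h₄ ()
    g-antisym false false true true h₁ h₂ h₃ h₄ = ⊥-elim (h₂ refl refl)
    g-antisym false false true false h₁ h₂ h₃ h₄ _ ()
    g-antisym false false false b' h₁ h₂ h₃ h₄ ()
    exchange : ∀ a a' b b' → NotBoth a a' → NotBoth b b' → NotBoth b a → NotBoth b' a' →
      ind ((a ∧ not b') ∨ (b ∧ not a')) + (ind a' + ind b') ≡ ind ((a' ∧ not b) ∨ (b' ∧ not a)) + (ind a + ind b)
    exchange true true b b' h₁ h₂ h₃ h₄ = ⊥-elim (h₁ refl refl)
    exchange true false true b' h₁ h₂ h₃ h₄ = ⊥-elim (h₃ refl refl)
    exchange true false false true h₁ h₂ h₃ h₄ = refl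
    exchange true false false false h₁ h₂ h₃ h₄ = refl
    exchange false true b true h₁ h₂ h₃ h₄ = ⊥-elim (h₄ refl refl)
    exchange false true true false h₁ h₂ h₃ h₄ = refl
    exchange false true false false h₁ h₂ h₃ h₄ = refl
    exchange false false true true h₁ h₂ h₃ h₄ = ⊥-elim (h₂ refl refl)
    exchange false false true false h₁ h₂ h₃ h₄ = refl
    exchange false false false true h₁ h₂ h₃ h₄ = refl
    exchange false false false false h₁ h₂ h₃ h₄ = refl

  -- A set closed in the residual graph is crossed by the flow along all its
  -- outgoing edges and none of its incoming ones.
  saturated-cut : ∀ {k} → Symm G → (f : Flow G u v k) → ∀ X → X u ≡ true → X v ≡ false →
    IsClosed (residual f) X → cut G X ≡ k
  saturated-cut {k} Gs f X Xu Xv closed = begin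
    cut G X ≡⟨ card₂-cong out ⟩
    cut (flow f) X ≡⟨ flow-across f X Xu Xv ⟩
    cut (flip (flow f)) X + k
      ≡⟨ cong (_+ k) (trans (card₂-cong {g = λ _ _ → false} into)
           (trans (sum-cong-≗ {N} (λ _ → sum-zero N)) (sum-zero N))) ⟩
    k ∎
    where
    open ≡-Reasoning
    full : ∀ i j → X i ≡ true → X j ≡ false → G i j ≡ flow f i j
    full i j Xi Xj with G i j in Gij | flow f i j in fij | closed i j Xi Xj
    ... | true | true | _ = refl
    ... | false | false | _ = refl
    ... | false | true | _ = trans (sym Gij) (flow⊆ f i j fij)
    out : ∀ i j → X i ∧ (not (X j) ∧ G i j) ≡ X i ∧ (not (X j) ∧ flow f i j)
    out i j with X i in Xi | X j in Xj
    ... | false | _ = refl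
    ... | true | true = refl
    ... | true | false = full i j Xi Xj
    into : ∀ i j → X i ∧ (not (X j) ∧ flow f j i) ≡ false
    into i j with X i in Xi | X j in Xj
    ... | false | _ = refl
    ... | true | true = refl
    ... | true | false = ¬-not λ fji → antisym f j i fji
            (trans (sym (full i j Xi Xj)) (trans (Gs i j) (flow⊆ f j i fji)))

  -- Augmentation from value k can fail only at a saturated cut, whose size would be exactly k,
  -- against the assumption that all cuts have at least k + 1 edges.
  maxflow : Symm G → ∀ k → (∀ X → X u ≡ true → X v ≡ false → k ≤ cut G X) → Flow G u v k
  maxflow Gs zero _ = record
    { flow = λ _ _ → false ; flow⊆ = λ _ _ () ; antisym = λ _ _ ()
    ; balance = λ i _ → sym (+-identityʳ (# {N} (λ _ → false))) }
  maxflow Gs (suc k) h = step (maxflow Gs k λ X Xu Xv → <⇒≤ (h X Xu Xv))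
    where
    step : Flow G u v k → Flow G u v (suc k)
    step f with path-or-closed (residual f) u v
    ... | inj₁ (p , isPath) = augment f p isPath
    ... | inj₂ (X , Xu , Xv , closed) =
      contradiction (≤-reflexive (saturated-cut Gs f X Xu Xv closed)) (<⇒≱ (h X Xu Xv))

menger⇒SMλ : ∀ {N} (G : Adj N) → Symm G → MinDegAtLeast 1 G →
  (∀ u v X → X u ≡ true → X v ≡ false → deg G u ⊓ deg G v ≤ cut G X) → SMλ G
menger⇒SMλ {N} G Gs pos cuts = connected , λ u v _ → let ps , isPath , disjoint , _ = paths u v in ps , isPath , disjoint
  where
  paths : ∀ u v → _
  paths u v = let f = maxflow {u = u} {v} Gs (deg G u ⊓ deg G v) (cuts u v) in flow⇒paths _ f
  connected : Connected G
  -- Positive degrees ensure that there is a first path. For u = v the cut condition is vacuous, so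
  -- this case needs no separate treatment.
  connected u v = proj₁ (paths u v) (fromℕ< (⊓-glb (pos u) (pos v)))

-- HL-networks

↑-elim : ∀ m {n} (P : Fin (m + n) → Set) → (∀ a → P (a ↑ˡ n)) → (∀ b → P (m ↑ʳ b)) → ∀ i → P i
↑-elim m P l r i with splitAt m i in eq
... | inj₁ a = subst P (splitAt⁻¹-↑ˡ eq) (l a)
... | inj₂ b = subst P (splitAt⁻¹-↑ʳ eq) (r b)

card₂-splitAt : ∀ m (f : Fin (m + m) → Fin (m + m) → Bool) →
  card₂ f ≡ (card₂ (λ a b → f (a ↑ˡ m) (b ↑ˡ m)) + card₂ (λ a b → f (a ↑ˡ m) (m ↑ʳ b)))
          + (card₂ (λ a b → f (m ↑ʳ a) (b ↑ˡ m)) + card₂ (λ a b → f (m ↑ʳ a) (m ↑ʳ b)))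
card₂-splitAt m f = trans (sum-splitAt m (# ∘ f))
  (cong₂ _+_ (sum-cong-+ λ a → sum-splitAt m (ind ∘ f (a ↑ˡ m)))
             (sum-cong-+ λ a → sum-splitAt m (ind ∘ f (m ↑ʳ a))))

module _ {m} {A B : Adj m} {φ : Fin m ⤖ Fin m} where

  open Bijection φ using (to; injective; strictlySurjective)

  ⊕-ll : ∀ a b → ⊕ A B φ (a ↑ˡ m) (b ↑ˡ m) ≡ A a b
  ⊕-ll a b rewrite splitAt-↑ˡ m a m | splitAt-↑ˡ m b m = refl

  ⊕-lr : ∀ a b → ⊕ A B φ (a ↑ˡ m) (m ↑ʳ b) ≡ ⌊ to a ≟ b ⌋
  ⊕-lr a b rewrite splitAt-↑ˡ m a m | splitAt-↑ʳ m m b = refl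

  ⊕-rl : ∀ a b → ⊕ A B φ (m ↑ʳ a) (b ↑ˡ m) ≡ ⌊ to b ≟ a ⌋
  ⊕-rl a b rewrite splitAt-↑ʳ m m a | splitAt-↑ˡ m b m = refl

  ⊕-rr : ∀ a b → ⊕ A B φ (m ↑ʳ a) (m ↑ʳ b) ≡ B a b
  ⊕-rr a b rewrite splitAt-↑ʳ m m a | splitAt-↑ʳ m m b = refl

  #-preimage : ∀ b → # (λ a → ⌊ to a ≟ b ⌋) ≡ 1
  #-preimage b = let a , to-a = strictlySurjective b in
    #≡1 (λ a → ⌊ to a ≟ b ⌋) a (trans (cong (λ z → ⌊ z ≟ b ⌋) to-a) (⌊≟⌋-refl b))
      λ i j p q → injective (trans (⌊≟⌋-sound p) (sym (⌊≟⌋-sound q)))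

  ⊕-symm : Symm A → Symm B → Symm (⊕ A B φ)
  ⊕-symm As Bs = ↑-elim m _
    (λ a → ↑-elim m _ (λ b → trans (⊕-ll a b) (trans (As a b) (sym (⊕-ll b a))))
                      (λ b → trans (⊕-lr a b) (sym (⊕-rl b a))))
    (λ a → ↑-elim m _ (λ b → trans (⊕-rl a b) (sym (⊕-lr b a)))
                      (λ b → trans (⊕-rr a b) (trans (Bs a b) (sym (⊕-rr b a)))))

  ⊕-regular : ∀ {k} → (∀ a → # (A a) ≡ k) → (∀ b → # (B b) ≡ k) → ∀ i → # (⊕ A B φ i) ≡ suc k
  ⊕-regular {k} Ak Bk = ↑-elim m _
    (λ a → begin
      # (⊕ A B φ (a ↑ˡ m)) ≡⟨ sum-splitAt m (ind ∘ ⊕ A B φ (a ↑ˡ m)) ⟩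
      # (λ b → ⊕ A B φ (a ↑ˡ m) (b ↑ˡ m)) + # (λ b → ⊕ A B φ (a ↑ˡ m) (m ↑ʳ b))
        ≡⟨ cong₂ _+_ (#-cong (⊕-ll a)) (#-cong (⊕-lr a)) ⟩
      # (A a) + # (λ b → ⌊ to a ≟ b ⌋) ≡⟨ cong₂ _+_ (Ak a) (#-singleton (to a)) ⟩
      k + 1 ≡⟨ +-comm k 1 ⟩
      suc k ∎)
    (λ b → begin
      # (⊕ A B φ (m ↑ʳ b)) ≡⟨ sum-splitAt m (ind ∘ ⊕ A B φ (m ↑ʳ b)) ⟩
      # (λ a → ⊕ A B φ (m ↑ʳ b) (a ↑ˡ m)) + # (λ a → ⊕ A B φ (m ↑ʳ b) (m ↑ʳ a))
        ≡⟨ cong₂ _+_ (#-cong (⊕-rl b)) (#-cong (⊕-rr b)) ⟩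
      # (λ a → ⌊ to a ≟ b ⌋) + # (B b) ≡⟨ cong₂ _+_ (#-preimage b) (Bk b) ⟩
      suc k ∎)
    where open ≡-Reasoning

  module _ (X : VSet (m + m)) where

    private
      X₀ = λ a → X (a ↑ˡ m)
      X₁ = λ b → X (m ↑ʳ b)

      crossing : ℕ
      crossing = card₂ (λ a b → X₀ a ∧ (X₁ b ∧ ⌊ to a ≟ b ⌋))

    ⊕-inner : inner (⊕ A B φ) X ≡ inner A X₀ + inner B X₁ + (crossing + crossing)
    ⊕-inner = begin
      inner (⊕ A B φ) X ≡⟨ card₂-splitAt m (λ i j → X i ∧ (X j ∧ ⊕ A B φ i j)) ⟩
      _ ≡⟨ cong₂ _+_
             (cong₂ _+_ (card₂-cong λ a b → cong (λ z → X₀ a ∧ (X₀ b ∧ z)) (⊕-ll a b))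
                        (card₂-cong λ a b → cong (λ z → X₀ a ∧ (X₁ b ∧ z)) (⊕-lr a b)))
             (cong₂ _+_ (trans (card₂-cong λ b a → trans (cong (λ z → X₁ b ∧ (X₀ a ∧ z)) (⊕-rl b a))
                                                     (swap (X₁ b) (X₀ a) ⌊ to a ≟ b ⌋))
                               (card₂-swap (λ b a → X₀ a ∧ (X₁ b ∧ ⌊ to a ≟ b ⌋))))
                        (card₂-cong λ a b → cong (λ z → X₁ a ∧ (X₁ b ∧ z)) (⊕-rr a b))) ⟩
      inner A X₀ + crossing + (crossing + inner B X₁) ≡⟨ rearrange (inner A X₀) crossing (inner B X₁) ⟩
      inner A X₀ + inner B X₁ + (crossing + crossing) ∎
      where
      open ≡-Reasoning
      swap : ∀ a b c → a ∧ (b ∧ c) ≡ b ∧ (a ∧ c)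
      swap true b c = refl
      swap false true c = refl
      swap false false c = refl
      rearrange : ∀ a c b → a + c + (c + b) ≡ a + b + (c + c)
      rearrange = solve-∀

    private
      crossing≤₀ : crossing ≤ # X₀
      crossing≤₀ = sum-mono row
        where
        row : ∀ a → # (λ b → X₀ a ∧ (X₁ b ∧ ⌊ to a ≟ b ⌋)) ≤ ind (X₀ a)
        row a with X₀ a
        ... | false = ≤-reflexive (sum-zero m)
        ... | true = #≤1 (λ b → X₁ b ∧ ⌊ to a ≟ b ⌋) λ i j p q →
                trans (sym (⌊≟⌋-sound (∧-right {X₁ i} p))) (⌊≟⌋-sound (∧-right {X₁ j} q))

      crossing≤₁ : crossing ≤ # X₁
      crossing≤₁ = ≤-trans (≤-reflexive (card₂-swap (λ a b → X₀ a ∧ (X₁ b ∧ ⌊ to a ≟ b ⌋)))) (sum-mono row)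
        where
        row : ∀ b → # (λ a → X₀ a ∧ (X₁ b ∧ ⌊ to a ≟ b ⌋)) ≤ ind (X₁ b)
        row b with X₁ b
        ... | false = ≤-reflexive (#-empty {f = λ a → X₀ a ∧ false} λ a → ∧-zeroʳ (X₀ a))
        ... | true = #≤1 (λ a → X₀ a ∧ ⌊ to a ≟ b ⌋) λ i j p q →
                injective (trans (⌊≟⌋-sound (∧-right {X₀ i} p)) (sym (⌊≟⌋-sound (∧-right {X₀ j} q))))

    -- A matching edge inside X uses up one vertex on each side, so c is bounded by both sizes;
    -- superadditivity needs the bound by the smaller one.
    ⊕-inner-≤ : ∃ λ c → c ≤ # X₀ × c ≤ # X₁ × inner (⊕ A B φ) X ≡ inner A X₀ + inner B X₁ + (c + c)
    ⊕-inner-≤ = crossing , crossing≤₀ , crossing≤₁ , ⊕-inner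

HL-symm : ∀ {n G} → HL n G → Symm G
HL-symm hl0 i j = refl
HL-symm (hlS hA hB φ) = ⊕-symm {φ = φ} (HL-symm hA) (HL-symm hB)

HL-regular : ∀ {n G} → HL n G → ∀ i → # (G i) ≡ n
HL-regular hl0 i = refl
HL-regular (hlS hA hB φ) = ⊕-regular {φ = φ} (HL-regular hA) (HL-regular hB)

#≤N : ∀ {N} (X : VSet N) → # X ≤ N
#≤N X = ≤-trans (m≤m+n _ _) (≤-reflexive (#-complement X))

HL-inner≤D : ∀ {n G} → HL n G → ∀ X → inner G X ≤ D n (# X)
HL-inner≤D hl0 X with X zero
... | true = ≤-refl
... | false = ≤-refl
HL-inner≤D (hlS {n} {A} {B} hA hB φ) X with ⊕-inner-≤ {A = A} {B} {φ} X
... | c , c≤₀ , c≤₁ , eq = begin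
  inner (⊕ A B φ) X ≡⟨ eq ⟩
  inner A X₀ + inner B X₁ + (c + c) ≤⟨ +-monoˡ-≤ _ (+-mono-≤ (HL-inner≤D hA X₀) (HL-inner≤D hB X₁)) ⟩
  D n (# X₀) + D n (# X₁) + (c + c) ≤⟨ superadditive (≤-total (# X₀) (# X₁)) ⟩
  D (suc n) (# X₀ + # X₁) ≡⟨ cong (D (suc n)) (sym (sum-splitAt (V n) (ind ∘ X))) ⟩
  D (suc n) (# X) ∎
  where
  open ≤-Reasoning
  X₀ : VSet (V n)
  X₀ a = X (a ↑ˡ V n)
  X₁ : VSet (V n)
  X₁ b = X (V n ↑ʳ b)
  superadditive : # X₀ ≤ # X₁ ⊎ # X₁ ≤ # X₀ → D n (# X₀) + D n (# X₁) + (c + c) ≤ D (suc n) (# X₀ + # X₁)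
  superadditive (inj₁ h) = ≤-trans (+-monoʳ-≤ (D n (# X₀) + D n (# X₁)) (+-mono-≤ c≤₀ c≤₀))
    (D-superadditive n (# X₀) (# X₁) h (#≤N X₁))
  superadditive (inj₂ h) = ≤-trans (+-mono-≤ (≤-reflexive (+-comm (D n (# X₀)) (D n (# X₁)))) (+-mono-≤ c≤₁ c≤₁))
    (≤-trans (D-superadditive n (# X₁) (# X₀) h (#≤N X₀)) (≤-reflexive (cong (D (suc n)) (+-comm (# X₁) (# X₀)))))

-- Edge sets and cuts

module _ {N : ℕ} where

  private
    lt : Fin N → Fin N → Bool
    lt i j = toℕ i <ᵇ toℕ j

    lt-asym : ∀ i j → lt i j ≡ true → lt j i ≡ true → ⊥
    lt-asym i j p q = <-asym (<ᵇ⇒< _ _ (subst T (sym p) _)) (<ᵇ⇒< (toℕ j) (toℕ i) (subst T (sym q) _))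

    T-true : ∀ {b} → T b → b ≡ true
    T-true {true} _ = refl

    lt-total : ∀ i j → i ≢ j → lt i j ≡ true ⊎ lt j i ≡ true
    lt-total i j i≢j with <-cmp (toℕ i) (toℕ j)
    ... | tri< p _ _ = inj₁ (T-true (<⇒<ᵇ p))
    ... | tri≈ _ p _ = contradiction (toℕ-injective p) i≢j
    ... | tri> _ _ p = inj₂ (T-true (<⇒<ᵇ p))

    card₂-+-mono : {f g h : Fin N → Fin N → Bool} → (∀ i j → ind (f i j) + ind (g i j) ≤ ind (h i j)) →
      card₂ f + card₂ g ≤ card₂ h
    card₂-+-mono {f} {g} p = ≤-trans
      (≤-reflexive (sym (sum-cong-+ λ i → ∑-distrib-+ (ind ∘ f i) (ind ∘ g i))))
      (sum-mono (sum-mono ∘ p))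

  -- `cut` orients an edge out of X, `edgeCount` orients it by increasing index. Arcs leaving X
  -- against the index order are reversed; they then enter X and cannot coincide with the others.
  cut≤edgeCount : ∀ (F : Adj N) X → Symm F → cut F X ≤ edgeCount F
  cut≤edgeCount F X Fs = begin
    cut F X ≤⟨ card₂-mono-+ split ⟩
    card₂ (λ i j → (X i ∧ (not (X j) ∧ F i j)) ∧ lt i j) + card₂ (λ i j → (X i ∧ (not (X j) ∧ F i j)) ∧ lt j i)
      ≡⟨ cong (card₂ (λ i j → (X i ∧ (not (X j) ∧ F i j)) ∧ lt i j) +_)
           (card₂-swap (λ i j → (X i ∧ (not (X j) ∧ F i j)) ∧ lt j i)) ⟩
    card₂ (λ i j → (X i ∧ (not (X j) ∧ F i j)) ∧ lt i j) + card₂ (λ i j → (X j ∧ (not (X i) ∧ F j i)) ∧ lt i j)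
      ≤⟨ card₂-+-mono (λ i j → merge (X i) (X j) (F i j) (F j i) (lt i j) (Fs j i)) ⟩
    card₂ (λ i j → F i j ∧ lt i j) ≡⟨ sym (edgeCount≡card₂ F) ⟩
    edgeCount F ∎
    where
    open ≤-Reasoning
    pointwise : ∀ a b c → b ≡ true ⊎ c ≡ true → ind a ≤ ind (a ∧ b) + ind (a ∧ c)
    pointwise false b c _ = z≤n
    pointwise true true c _ = s≤s z≤n
    pointwise true false true _ = ≤-refl
    pointwise true false false (inj₁ ())
    pointwise true false false (inj₂ ())
    split : ∀ i j → ind (X i ∧ (not (X j) ∧ F i j)) ≤
      ind ((X i ∧ (not (X j) ∧ F i j)) ∧ lt i j) + ind ((X i ∧ (not (X j) ∧ F i j)) ∧ lt j i)
    split i j with X i in Xi | X j in Xj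
    ... | false | _ = z≤n
    ... | true | true = z≤n
    ... | true | false = pointwise (F i j) (lt i j) (lt j i)
            (lt-total i j λ i≡j → true≢false Xi (trans (cong X i≡j) Xj))
    merge : ∀ a b c c' d → c' ≡ c → ind ((a ∧ (not b ∧ c)) ∧ d) + ind ((b ∧ (not a ∧ c')) ∧ d) ≤ ind (c ∧ d)
    merge true true c c' d _ = z≤n
    merge true false c c' d _ = ≤-reflexive (+-identityʳ _)
    merge false true c c' d refl = ≤-refl
    merge false false c c' d _ = z≤n

  edgeCount≤cut : ∀ (F : Adj N) X → Symm F → (∀ i j → F i j ≡ true → X i ≡ not (X j)) → edgeCount F ≤ cut F X
  edgeCount≤cut F X Fs crosses = begin
    edgeCount F ≡⟨ edgeCount≡card₂ F ⟩
    card₂ (λ i j → F i j ∧ lt i j)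
      ≤⟨ card₂-mono-+ (λ i j → split (X i) (X j) (F i j) (F j i) (lt i j) (Fs i j) (crosses i j)) ⟩
    card₂ (λ i j → (X i ∧ (not (X j) ∧ F i j)) ∧ lt i j) + card₂ (λ i j → (X j ∧ (not (X i) ∧ F j i)) ∧ lt i j)
      ≡⟨ cong (card₂ (λ i j → (X i ∧ (not (X j) ∧ F i j)) ∧ lt i j) +_)
           (card₂-swap (λ i j → (X j ∧ (not (X i) ∧ F j i)) ∧ lt i j)) ⟩
    card₂ (λ i j → (X i ∧ (not (X j) ∧ F i j)) ∧ lt i j) + card₂ (λ i j → (X i ∧ (not (X j) ∧ F i j)) ∧ lt j i)
      ≤⟨ card₂-+-mono (λ i j → merge (X i ∧ (not (X j) ∧ F i j)) (lt i j) (lt j i) (lt-asym i j)) ⟩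
    cut F X ∎
    where
    open ≤-Reasoning
    merge : ∀ a b c → (b ≡ true → c ≡ true → ⊥) → ind (a ∧ b) + ind (a ∧ c) ≤ ind a
    merge false b c h = z≤n
    merge true true true h = ⊥-elim (h refl refl)
    merge true true false h = ≤-refl
    merge true false true h = ≤-refl
    merge true false false h = z≤n
    split : ∀ a b c c' d → c ≡ c' → (c ≡ true → a ≡ not b) →
      ind (c ∧ d) ≤ ind ((a ∧ (not b ∧ c)) ∧ d) + ind ((b ∧ (not a ∧ c')) ∧ d)
    split a b false c' d _ h = z≤n
    split true b true c' d _ h with b | h refl
    ... | false | _ = m≤m+n _ _
    split false b true c' d refl h with b | h refl
    ... | true | _ = ≤-refl

  cut-≤-cut-─ : ∀ (G F : Adj N) X → cut G X ≤ cut (G ─ F) X + cut F X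
  cut-≤-cut-─ G F X = card₂-mono-+ λ i j → lem (X i) (X j) (G i j) (F i j)
    where
    lem : ∀ a b c d → ind (a ∧ (not b ∧ c)) ≤ ind (a ∧ (not b ∧ (c ∧ not d))) + ind (a ∧ (not b ∧ d))
    lem false b c d = z≤n
    lem true true c d = z≤n
    lem true false false d = z≤n
    lem true false true true = ≤-refl
    lem true false true false = ≤-refl

  ─-symm : ∀ {G F : Adj N} → Symm G → Symm F → Symm (G ─ F)
  ─-symm Gs Fs i j = cong₂ (λ g f → g ∧ not f) (Gs i j) (Fs i j)

  deg-─-≤ : ∀ (G F : Adj N) i → # ((G ─ F) i) ≤ # (G i)
  deg-─-≤ G F i = sum-mono λ j → lem (G i j) (F i j)
    where
    lem : ∀ a b → ind (a ∧ not b) ≤ ind a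
    lem false b = z≤n
    lem true true = z≤n
    lem true false = ≤-refl

  vol-regular : ∀ {k} (G : Adj N) → (∀ i → # (G i) ≡ k) → ∀ X → vol G X ≡ k * # X
  vol-regular {k} G reg X = trans (sum-cong-≗ row) (sym (*-distribˡ-sum k (ind ∘ X)))
    where
    row : ∀ i → # (λ j → X i ∧ G i j) ≡ k * ind (X i)
    row i with X i
    ... | true = trans (reg i) (sym (*-identityʳ k))
    ... | false = trans (sum-zero N) (sym (*-zeroʳ k))

  -- The vertex u contributes its own degree and every other vertex of X at least r; the r on the
  -- right stands for the share of u in `r * # X`.
  vol-lower : ∀ {r} (H : Adj N) → (∀ i → r ≤ # (H i)) → ∀ X u → X u ≡ true → # (H u) + r * # X ≤ vol H X + r
  vol-lower {r} H minDeg X u Xu = begin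
    # (H u) + r * # X
      ≡⟨ cong₂ _+_ (sym (at-u (# (H u)))) (*-distribˡ-sum r (ind ∘ X)) ⟩
    sum (λ i → # (H u) * ind ⌊ u ≟ i ⌋) + sum (λ i → r * ind (X i))
      ≡⟨ sym (∑-distrib-+ (λ i → # (H u) * ind ⌊ u ≟ i ⌋) (λ i → r * ind (X i))) ⟩
    sum (λ i → # (H u) * ind ⌊ u ≟ i ⌋ + r * ind (X i)) ≤⟨ sum-mono-+ row ⟩
    vol H X + sum (λ i → r * ind ⌊ u ≟ i ⌋) ≡⟨ cong (vol H X +_) (at-u r) ⟩
    vol H X + r ∎
    where
    open ≤-Reasoning
    at-u : ∀ k → sum (λ i → k * ind ⌊ u ≟ i ⌋) ≡ k
    at-u k = trans (sym (*-distribˡ-sum k (λ i → ind ⌊ u ≟ i ⌋)))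
      (trans (cong (k *_) (#-singleton u)) (*-identityʳ k))
    row : ∀ i → # (H u) * ind ⌊ u ≟ i ⌋ + r * ind (X i) ≤ # (λ j → X i ∧ H i j) + r * ind ⌊ u ≟ i ⌋
    row i with u ≟ i
    ... | yes refl rewrite Xu = ≤-reflexive (cong (_+ r * 1) (*-identityʳ _))
    ... | no _ with X i
    ...   | true = begin
      # (H u) * 0 + r * 1 ≡⟨ cong₂ _+_ (*-zeroʳ (# (H u))) (*-identityʳ r) ⟩
      r ≤⟨ minDeg i ⟩
      # (H i) ≤⟨ m≤m+n _ _ ⟩
      # (H i) + r * 0 ∎
    ...   | false = ≤-trans (≤-reflexive (cong (_+ r * 0) (*-zeroʳ (# (H u))))) (m≤n+m _ _)

-- Cuts after the removal of few edges

module _ {n r t} (n≡ : n ≡ suc (r + t)) (n≤ : n ≤ V r * suc t) {G : Adj (V n)} (hG : HL n G)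
  {F : Adj (V n)} (F⊆G : EdgeSubset G F) (few : edgeCount F ≤ V r * suc t ∸ n)
  (minDeg : MinDegAtLeast r (G ─ F)) where

  private
    H = G ─ F

    minDeg# : ∀ i → r ≤ # (H i)
    minDeg# i = subst (r ≤_) (countB≡# (H i)) (minDeg i)

  deg≤cut-small : ∀ X u → X u ≡ true → # X ≤ V (r + t) → # (H u) ≤ cut H X
  deg≤cut-small X u Xu X≤ with ≤-<-connex (V r) (# X)
  -- No degree in `H` exceeds n, so it is enough that n of the at least W boundary edges survive the
  -- removal of at most W - n.
  ... | inj₁ large = ≤-trans (deg-─-≤ G F u) (≤-trans (≤-reflexive (HL-regular hG u))
          (+-cancelʳ-≤ (W ∸ n) n (cut H X) (begin
            n + (W ∸ n) ≡⟨ m+[n∸m]≡n n≤ ⟩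
            W ≤⟨ +-cancelˡ-≤ (D n (# X)) W (cut G X) middle ⟩
            cut G X ≤⟨ cut-≤-cut-─ G F X ⟩
            cut H X + cut F X ≤⟨ +-monoʳ-≤ (cut H X) (≤-trans (cut≤edgeCount F X (proj₁ F⊆G)) few) ⟩
            cut H X + (W ∸ n) ∎)))
    where
    open ≤-Reasoning
    W = V r * suc t
    middle : D n (# X) + W ≤ D n (# X) + cut G X
    middle = begin
      D n (# X) + W ≤⟨ D-middle n r t (# X) large X≤ ⟩
      suc (r + t) * # X ≡⟨ cong (_* # X) (sym n≡) ⟩
      n * # X ≡⟨ sym (vol-regular G (HL-regular hG) X) ⟩
      vol G X ≡⟨ vol≡inner+cut G X ⟩
      inner G X + cut G X ≤⟨ +-monoˡ-≤ (cut G X) (HL-inner≤D hG X) ⟩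
      D n (# X) + cut G X ∎
  -- Here the size of F is irrelevant: the degree sum in `H` is bounded below by the minimum degree,
  -- and what the inside of X cannot absorb must leave X.
  ... | inj₂ small = +-cancelʳ-≤ (r * # X) _ _ (begin
    # (H u) + r * # X ≤⟨ vol-lower H minDeg# X u Xu ⟩
    vol H X + r ≡⟨ cong (_+ r) (vol≡inner+cut H X) ⟩
    inner H X + cut H X + r
      ≤⟨ +-monoˡ-≤ r (+-monoˡ-≤ (cut H X) (≤-trans (card₂-mono λ i j → lem (X i) (X j) (G i j) (F i j)) (HL-inner≤D hG X))) ⟩
    D n (# X) + cut H X + r ≡⟨ rearrange (D n (# X)) (cut H X) r ⟩
    cut H X + (D n (# X) + r) ≤⟨ +-monoʳ-≤ (cut H X) (D+r≤r*x n r (# X) (member⇒1≤# X u Xu) small) ⟩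
    cut H X + r * # X ∎)
    where
    open ≤-Reasoning
    rearrange : ∀ a b c → a + b + c ≡ b + (a + c)
    rearrange = solve-∀
    lem : ∀ a b c d → ind (a ∧ (b ∧ (c ∧ not d))) ≤ ind (a ∧ (b ∧ c))
    lem false b c d = z≤n
    lem true false c d = z≤n
    lem true true false d = z≤n
    lem true true true true = z≤n
    lem true true true false = ≤-refl

  -- The minimum permits a choice of endpoint: the one on the side with at most half of the
  -- vertices.
  deg⊓deg≤cut : ∀ u v X → X u ≡ true → X v ≡ false → deg H u ⊓ deg H v ≤ cut H X
  deg⊓deg≤cut u v X Xu Xv with ≤-total (# X) (V (r + t))
  ... | inj₁ X≤ = ≤-trans (m⊓n≤m _ _) (subst (_≤ cut H X) (sym (countB≡# (H u))) (deg≤cut-small X u Xu X≤))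
  ... | inj₂ X≥ = ≤-trans (m⊓n≤n (deg H u) _) (subst₂ _≤_ (sym (countB≡# (H v)))
      (cut-complement H X (─-symm {G = G} {F} (HL-symm hG) (proj₁ F⊆G)))
      (deg≤cut-small (not ∘ X) v (not-false Xv) complement≤))
    where
    complement≤ : # (not ∘ X) ≤ V (r + t)
    complement≤ = +-cancelˡ-≤ (V (r + t)) _ _ (≤-trans (+-monoˡ-≤ (# (not ∘ X)) X≥)
      (≤-reflexive (trans (#-complement X) (cong V n≡))))

  SMλ-after-removal : 1 ≤ r → SMλ (G ─ F)
  SMλ-after-removal 1≤r = menger⇒SMλ H (─-symm {G = G} {F} (HL-symm hG) (proj₁ F⊆G))
    (λ i → ≤-trans 1≤r (minDeg i)) deg⊓deg≤cut

-- The extremal edge set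

module _ {N} {H : Adj N} {u v : Fin N} (X : VSet N) (Xu : X u ≡ true) (Xv : X v ≡ false) where

  private
    Crossing : ∀ {w} → Walk H w v → Set
    Crossing p = Σ (Fin N) λ a → Σ (Fin N) λ b →
      (a , b) ∈ edges p × X a ≡ true × X b ≡ false × H a b ≡ true

    crossing : ∀ {w} (p : Walk H w v) → X w ≡ true → Crossing p
    crossing [] Xw = ⊥-elim (true≢false Xw Xv)
    crossing (_∷_ {w = x} e p) Xw with X x in Xx
    ... | false = _ , x , here refl , Xw , Xx , e
    ... | true = let a , b , ab∈ , rest = crossing p Xx in a , b , there ab∈ , rest

  -- Each walk leaves X along some arc, and disjointness makes the chosen arcs distinct. The pairs
  -- of a walk and its chosen arc are counted first by walks, then by arcs.
  disjoint-walks≤cut : ∀ {k} (ps : Fin k → Walk H u v) →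
    (∀ i j → i ≢ j → EdgeDisjoint (ps i) (ps j)) → k ≤ cut H X
  disjoint-walks≤cut {k} ps disjoint = begin
    k ≡⟨ sym (sum-one k) ⟩
    sum {k} (λ _ → 1) ≡⟨ sum-cong-≗ (λ s → sym (trans (sum-cong-≗ λ i → #-∧ˡ ⌊ a s ≟ i ⌋ (b s)) (#-singleton (a s)))) ⟩
    sum (λ s → sum (λ i → sum (λ j → hit s i j))) ≡⟨ ∑-comm (λ s i → sum (λ j → hit s i j)) ⟩
    sum (λ i → sum (λ s → sum (λ j → hit s i j))) ≡⟨ sum-cong-≗ (λ i → ∑-comm (λ s j → hit s i j)) ⟩
    sum (λ i → sum (λ j → sum (λ s → hit s i j))) ≤⟨ sum-mono (λ i → sum-mono (λ j → bound i j)) ⟩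
    cut H X ∎
    where
    open ≤-Reasoning
    c : ∀ s → Crossing (ps s)
    c s = crossing (ps s) Xu
    a b : Fin k → Fin N
    a s = proj₁ (c s)
    b s = proj₁ (proj₂ (c s))
    hits : Fin k → Fin N → Fin N → Bool
    hits s i j = ⌊ a s ≟ i ⌋ ∧ ⌊ b s ≟ j ⌋
    hit : Fin k → Fin N → Fin N → ℕ
    hit s i j = ind (hits s i j)
    hits⇒∈ : ∀ {s i j} → hits s i j ≡ true →
      (i , j) ∈ edges (ps s) × X i ≡ true × X j ≡ false × H i j ≡ true
    hits⇒∈ {s} {i} h with ⌊≟⌋-sound {i = a s} (∧-left h) | ⌊≟⌋-sound {i = b s} (∧-right {⌊ a s ≟ i ⌋} h)
    ... | refl | refl = proj₂ (proj₂ (c s))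
    same : ∀ {i j} s s' → hits s i j ≡ true → hits s' i j ≡ true → s ≡ s'
    same s s' h h' with s ≟ s'
    ... | yes p = p
    ... | no s≢s' = ⊥-elim (disjoint s s' s≢s' _ _ (proj₁ (hits⇒∈ h)) (inj₁ (proj₁ (hits⇒∈ h'))))
    bound : ∀ i j → sum (λ s → hit s i j) ≤ ind (X i ∧ (not (X j) ∧ H i j))
    bound i j with X i ∧ (not (X j) ∧ H i j) in eq
    ... | true = #≤1 (λ s → hits s i j) same
    ... | false = ≤-reflexive (#-empty {f = λ s → hits s i j} λ s → ¬-not λ h →
            let _ , Xi , Xj , Hij = hits⇒∈ h in
            true≢false (cong₂ _∧_ Xi (cong₂ (λ x y → not x ∧ y) Xj Hij)) eq)

-- The role of a subcube is played by an r-regular induced subgraph on 2^r vertices. The field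
-- `outside` limits to one the edges that an outer vertex can lose when boundary edges are removed.
record Subcube {N} (r : ℕ) (G : Adj N) : Set where
  field
    X : VSet N
    size : # X ≡ V r
    inside : ∀ i → X i ≡ true → # (λ j → X j ∧ G i j) ≡ r
    outside : ∀ i → X i ≡ false → # (λ j → X j ∧ G i j) ≤ 1

module _ {m} {A B : Adj m} {φ : Fin m ⤖ Fin m} where

  open Bijection φ using (to; injective)

  leftPart : VSet m → VSet (m + m)
  leftPart X i = [ X , const false ]′ (splitAt m i)

  leftPart-l : ∀ X a → leftPart X (a ↑ˡ m) ≡ X a
  leftPart-l X a rewrite splitAt-↑ˡ m a m = refl

  leftPart-r : ∀ X b → leftPart X (m ↑ʳ b) ≡ false
  leftPart-r X b rewrite splitAt-↑ʳ m m b = refl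

  private
    sizeˡ : ∀ X (Z : VSet (m + m)) → # (λ j → leftPart X j ∧ Z j) ≡ # (λ a → X a ∧ Z (a ↑ˡ m))
    sizeˡ X Z = begin
      # (λ j → leftPart X j ∧ Z j) ≡⟨ sum-splitAt m (λ j → ind (leftPart X j ∧ Z j)) ⟩
      # (λ a → leftPart X (a ↑ˡ m) ∧ Z (a ↑ˡ m)) + # (λ b → leftPart X (m ↑ʳ b) ∧ Z (m ↑ʳ b))
        ≡⟨ cong₂ _+_ (#-cong λ a → cong (_∧ Z (a ↑ˡ m)) (leftPart-l X a))
             (#-empty {f = λ b → leftPart X (m ↑ʳ b) ∧ Z (m ↑ʳ b)} λ b → cong (_∧ Z (m ↑ʳ b)) (leftPart-r X b)) ⟩
      # (λ a → X a ∧ Z (a ↑ˡ m)) + 0 ≡⟨ +-identityʳ _ ⟩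
      # (λ a → X a ∧ Z (a ↑ˡ m)) ∎
      where open ≡-Reasoning

    neighboursˡ : ∀ X a → # (λ j → leftPart X j ∧ ⊕ A B φ (a ↑ˡ m) j) ≡ # (λ b → X b ∧ A a b)
    neighboursˡ X a = trans (sizeˡ X (⊕ A B φ (a ↑ˡ m))) (#-cong λ b → cong (X b ∧_) (⊕-ll a b))

    neighboursʳ : ∀ X b → # (λ j → leftPart X j ∧ ⊕ A B φ (m ↑ʳ b) j) ≤ 1
    neighboursʳ X b = ≤-trans (≤-reflexive (trans (sizeˡ X (⊕ A B φ (m ↑ʳ b))) (#-cong λ a → cong (X a ∧_) (⊕-rl b a))))
      (#≤1 (λ a → X a ∧ ⌊ to a ≟ b ⌋) λ i j p q →
        injective (trans (⌊≟⌋-sound (∧-right {X i} p)) (sym (⌊≟⌋-sound (∧-right {X j} q)))))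

  ⊕-subcube : ∀ {r} → Subcube r A → Subcube r (⊕ A B φ)
  ⊕-subcube c = record
    { X = leftPart X
    ; size = trans (trans (sum-splitAt m (ind ∘ leftPart X)) (cong₂ _+_ (#-cong (leftPart-l X)) (#-empty (leftPart-r X))))
        (trans (+-identityʳ _) size)
    ; inside = ↑-elim m _
        (λ a Xa → trans (neighboursˡ X a) (inside a (trans (sym (leftPart-l X a)) Xa)))
        (λ b Xb → ⊥-elim (true≢false Xb (leftPart-r X b)))
    ; outside = ↑-elim m _
        (λ a Xa → ≤-trans (≤-reflexive (neighboursˡ X a)) (outside a (trans (sym (leftPart-l X a)) Xa)))
        (λ b _ → neighboursʳ X b)
    }
    where open Subcube c

  rightHalf : VSet (m + m)
  rightHalf i = [ const false , const true ]′ (splitAt m i)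

  rightHalf-r : ∀ b → rightHalf (m ↑ʳ b) ≡ true
  rightHalf-r b rewrite splitAt-↑ʳ m m b = refl

  rightNeighbours : ∀ X i → leftPart X i ≡ true →
    # (λ j → not (leftPart X j) ∧ (⊕ A B φ i j ∧ rightHalf j)) ≡ 1
  rightNeighbours X = ↑-elim m _
    (λ a _ → trans (sum-splitAt m (λ j → ind (not (leftPart X j) ∧ (⊕ A B φ (a ↑ˡ m) j ∧ rightHalf j))))
      (cong₂ _+_ (#-empty {f = λ b → not (leftPart X (b ↑ˡ m)) ∧ (⊕ A B φ (a ↑ˡ m) (b ↑ˡ m) ∧ rightHalf (b ↑ˡ m))} (inLeft a))
                 (trans (#-cong (inRight a)) (#-singleton (to a)))))
    (λ b Xb → ⊥-elim (true≢false Xb (leftPart-r X b)))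
    where
    inLeft : ∀ a b → not (leftPart X (b ↑ˡ m)) ∧ (⊕ A B φ (a ↑ˡ m) (b ↑ˡ m) ∧ rightHalf (b ↑ˡ m)) ≡ false
    inLeft a b rewrite splitAt-↑ˡ m b m = ∧-∧-zeroʳ (not (X b)) _
    inRight : ∀ a b → not (leftPart X (m ↑ʳ b)) ∧ (⊕ A B φ (a ↑ˡ m) (m ↑ʳ b) ∧ rightHalf (m ↑ʳ b)) ≡ ⌊ to a ≟ b ⌋
    inRight a b = trans (cong₂ (λ x y → not x ∧ y) (leftPart-r X b) (cong₂ _∧_ (⊕-lr a b) (rightHalf-r b))) (∧-identityʳ _)

  -- The partner of u in the last matching lies in the other half, and the matching is its only
  -- connection to the half that contains X.
  rightPartner : ∀ X u → leftPart X u ≡ true → ∃ λ v → leftPart X v ≡ false ×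
    (∀ j → leftPart X j ≡ true → ⊕ A B φ v j ≡ true → u ≡ j)
  rightPartner X = ↑-elim m _
    (λ a _ → m ↑ʳ to a , leftPart-r X (to a) , ↑-elim m _
      (λ b _ e → cong (_↑ˡ m) (sym (injective (⌊≟⌋-sound (trans (sym (⊕-rl (to a) b)) e)))))
      (λ b Xb _ → ⊥-elim (true≢false Xb (leftPart-r X b))))
    (λ b Xb → ⊥-elim (true≢false Xb (leftPart-r X b)))

-- Descending through left summands reaches a network of dimension r. A vertex outside a left
-- summand has just its matching partner in it.
subcube : ∀ {n G} → HL n G → ∀ r → r ≤ n → Subcube r G
subcube {n} hG r r≤n with m≤n⇒m<n∨m≡n r≤n
... | inj₂ refl = record
  { X = const true ; size = sum-one (V n) ; inside = λ i _ → HL-regular hG i ; outside = λ _ () }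
subcube (hlS hA hB φ) r r≤n | inj₁ r<n = ⊕-subcube {φ = φ} (subcube hA r (≤-pred r<n))

-- The dimension of the network is `suc n`, that is r + t + 1. Since r ≤ n, the subcube fits into
-- the summand A, and the whole last matching at X leads out of X.
module Extremal {n r t} (n≡ : n ≡ r + t) {A B : Adj (V n)} (hA : HL n A) (hB : HL n B)
  (φ : Fin (V n) ⤖ Fin (V n)) (1≤r : 1 ≤ r) where

  private
    G : Adj (V (suc n))
    G = ⊕ A B φ

    hG : HL (suc n) G
    hG = hlS hA hB φ

    cubeA : Subcube r A
    cubeA = subcube hA r (≤-trans (m≤m+n r t) (≤-reflexive (sym n≡)))

    open Subcube (⊕-subcube {B = B} {φ} cubeA)

    -- The cut must retain r + t edges. The vertex u, itself taken from S, accounts for t + 1 of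
    -- them, and the r - 1 other members of S for one each.
    kept : Σ (VSet (V (suc n))) λ S → (∀ i → S i ≡ true → X i ≡ true) × # S ≡ r
    kept = subset-of-size X r (≤-trans (r≤V r) (≤-reflexive (sym size)))
      where
      r≤V : ∀ r → r ≤ V r
      r≤V zero = z≤n
      r≤V (suc r) = ≤-trans (+-mono-≤ (V≥1 r) (r≤V r)) ≤-refl

    S : VSet (V (suc n))
    S = proj₁ kept

    S⊆X : ∀ i → S i ≡ true → X i ≡ true
    S⊆X = proj₁ (proj₂ kept)

    source : ∃ λ u → S u ≡ true
    source = 1≤#⇒member S (≤-trans 1≤r (≤-reflexive (sym (proj₂ (proj₂ kept)))))

    u : Fin (V (suc n))
    u = proj₁ source

    Xu : X u ≡ true
    Xu = S⊆X u (proj₂ source)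

    target : ∃ λ v → X v ≡ false × (∀ j → X j ≡ true → G v j ≡ true → u ≡ j)
    target = rightPartner {A = A} {B} {φ} (Subcube.X cubeA) u Xu

    v : Fin (V (suc n))
    v = proj₁ target

    Xv : X v ≡ false
    Xv = proj₁ (proj₂ target)

    right : VSet (V (suc n))
    right = rightHalf {A = A} {B} {φ}

    keep removed : Adj (V (suc n))
    -- At u all boundary edges stay; any other vertex of S retains just its edge of the last
    -- matching.
    keep i j = ⌊ u ≟ i ⌋ ∨ (S i ∧ right j)
    removed i j = X i ∧ (not (X j) ∧ not (keep i j))

  F : Adj (V (suc n))
  F i j = G i j ∧ (removed i j ∨ removed j i)

  private
    H : Adj (V (suc n))
    H = G ─ F

    Gs : Symm G
    Gs = HL-symm hG

    Fs : Symm F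
    Fs i j = cong₂ _∧_ (Gs i j) (∨-comm (removed i j) (removed j i))

  F⊆G : EdgeSubset G F
  F⊆G = Fs , λ i j → ∧-left

  private
    outerDegree : ∀ i → X i ≡ true → # (λ j → not (X j) ∧ G i j) ≡ suc t
    outerDegree i Xi = +-cancelˡ-≡ r _ _ (begin
      r + # (λ j → not (X j) ∧ G i j) ≡⟨ cong (_+ # (λ j → not (X j) ∧ G i j)) (sym (inside i Xi)) ⟩
      # (λ j → X j ∧ G i j) + # (λ j → not (X j) ∧ G i j) ≡⟨ sym (sum-cong-+ λ j → lem (X j) (G i j)) ⟩
      # (G i) ≡⟨ HL-regular hG i ⟩
      suc n ≡⟨ cong suc n≡ ⟩
      suc (r + t) ≡⟨ sym (+-suc r t) ⟩
      r + suc t ∎)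
      where
      open ≡-Reasoning
      lem : ∀ a b → ind b ≡ ind (a ∧ b) + ind (not a ∧ b)
      lem true b = sym (+-identityʳ _)
      lem false b = refl

    cutG : cut G X ≡ suc t * V r
    cutG = trans (sum-cong-≗ row) (trans (sym (*-distribˡ-sum (suc t) (ind ∘ X))) (cong (suc t *_) size))
      where
      row : ∀ i → # (λ j → X i ∧ (not (X j) ∧ G i j)) ≡ suc t * ind (X i)
      row i with X i in Xi
      ... | true = trans (outerDegree i Xi) (sym (*-identityʳ (suc t)))
      ... | false = trans (sum-zero (V (suc n))) (sym (*-zeroʳ (suc t)))

    cutH : cut H X ≡ t + r
    cutH = begin
      cut H X ≡⟨ card₂-cong (λ i j → lem (X i) (X j) (G i j) (keep i j) (keep j i)) ⟩
      card₂ (λ i j → X i ∧ (not (X j) ∧ (G i j ∧ keep i j))) ≡⟨ sum-cong-+ row ⟩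
      sum (λ i → t * ind ⌊ u ≟ i ⌋) + # S
        ≡⟨ cong₂ _+_ (trans (sym (*-distribˡ-sum t (λ i → ind ⌊ u ≟ i ⌋))) (trans (cong (t *_) (#-singleton u)) (*-identityʳ t)))
             (proj₂ (proj₂ kept)) ⟩
      t + r ∎
      where
      open ≡-Reasoning
      lem : ∀ a b g k k' → a ∧ (not b ∧ (g ∧ not (g ∧ ((a ∧ (not b ∧ not k)) ∨ (b ∧ (not a ∧ not k'))))))
        ≡ a ∧ (not b ∧ (g ∧ k))
      lem false b g k k' = refl
      lem true true g k k' = refl
      lem true false false k k' = refl
      lem true false true true k' = refl
      lem true false true false k' = refl
      row : ∀ i → # (λ j → X i ∧ (not (X j) ∧ (G i j ∧ keep i j))) ≡ t * ind ⌊ u ≟ i ⌋ + ind (S i)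
      row i with u ≟ i
      ... | yes refl rewrite Xu | proj₂ source = begin
        # (λ j → not (X j) ∧ (G u j ∧ true)) ≡⟨ #-cong (λ j → cong (not (X j) ∧_) (∧-identityʳ (G u j))) ⟩
        # (λ j → not (X j) ∧ G u j) ≡⟨ outerDegree u Xu ⟩
        suc t ≡⟨ sym (trans (cong (_+ 1) (*-identityʳ t)) (+-comm t 1)) ⟩
        t * 1 + 1 ∎
      ... | no _ rewrite *-zeroʳ t with X i in Xi | S i in Si
      ...   | true | true = rightNeighbours {A = A} {B} {φ} (Subcube.X cubeA) i Xi
      ...   | true | false = #-empty {f = λ j → not (X j) ∧ (G i j ∧ false)} λ j → ∧-∧-zeroʳ (not (X j)) (G i j)
      ...   | false | false = sum-zero (V (suc n))
      ...   | false | true = ⊥-elim (true≢false (S⊆X i Si) Xi)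

  F-size : edgeCount F + (t + r) ≤ suc t * V r
  F-size = begin
    edgeCount F + (t + r) ≤⟨ +-monoˡ-≤ (t + r) (edgeCount≤cut F X Fs λ i j → crosses (X i) (X j) (G i j) (keep i j) (keep j i)) ⟩
    cut F X + (t + r) ≡⟨ cong (cut F X +_) (sym cutH) ⟩
    cut F X + cut H X ≡⟨ sym (card₂-cong-+ λ i j → lem (X i) (X j) (G i j) (removed i j ∨ removed j i)) ⟩
    cut G X ≡⟨ cutG ⟩
    suc t * V r ∎
    where
    open ≤-Reasoning
    crosses : ∀ a b g k k' → g ∧ ((a ∧ (not b ∧ not k)) ∨ (b ∧ (not a ∧ not k'))) ≡ true → a ≡ not b
    crosses true true true k k' ()
    crosses true false g k k' _ = refl
    crosses false true g k k' _ = refl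
    crosses false false true k k' ()
    lem : ∀ a b g d → ind (a ∧ (not b ∧ g)) ≡ ind (a ∧ (not b ∧ (g ∧ d))) + ind (a ∧ (not b ∧ (g ∧ not (g ∧ d))))
    lem false b g d = refl
    lem true true g d = refl
    lem true false false d = refl
    lem true false true true = refl
    lem true false true false = refl

  minDegree : MinDegAtLeast r H
  minDegree i = subst (r ≤_) (sym (countB≡# (H i))) (bound (X i) refl)
    where
    bound : ∀ b → X i ≡ b → r ≤ # (H i)
    bound true Xi = ≤-trans (≤-reflexive (sym (inside i Xi)))
      (sum-mono λ j → lem (X i) (X j) (G i j) (keep i j) (keep j i) Xi)
      where
      lem : ∀ a b g k k' → a ≡ true →
        ind (b ∧ g) ≤ ind (g ∧ not (g ∧ ((a ∧ (not b ∧ not k)) ∨ (b ∧ (not a ∧ not k')))))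
      lem true false g k k' _ = z≤n
      lem true true true k k' _ = ≤-refl
      lem true true false k k' _ = ≤-refl
    -- An outer vertex loses at most its single edge into X, which leaves degree at least n ≥ r.
    bound false Xi = +-cancelʳ-≤ 1 r (# (H i)) (begin
      r + 1 ≡⟨ +-comm r 1 ⟩
      suc r ≤⟨ s≤s (m≤m+n r t) ⟩
      suc (r + t) ≡⟨ cong suc (sym n≡) ⟩
      suc n ≡⟨ sym (HL-regular hG i) ⟩
      # (G i) ≤⟨ sum-mono-+ (λ j → lem (X i) (X j) (G i j) (keep i j) (keep j i) Xi) ⟩
      # (H i) + # (λ j → X j ∧ G i j) ≤⟨ +-monoʳ-≤ (# (H i)) (outside i Xi) ⟩
      # (H i) + 1 ∎)
      where
      open ≤-Reasoning
      lem : ∀ a b g k k' → a ≡ false →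
        ind g ≤ ind (g ∧ not (g ∧ ((a ∧ (not b ∧ not k)) ∨ (b ∧ (not a ∧ not k'))))) + ind (b ∧ g)
      lem false b false k k' _ = z≤n
      lem false true true k k' _ = m≤n+m 1 _
      lem false false true k k' _ = ≤-refl

  private
    full-degree : ∀ i → (∀ j → F i j ≡ false) → deg H i ≡ suc n
    full-degree i none = trans (countB≡# (H i)) (trans (#-cong λ j → trans (cong (λ f → G i j ∧ not f) (none j)) (∧-identityʳ (G i j))) (HL-regular hG i))

    deg-u : deg H u ≡ suc n
    deg-u = full-degree u λ j → lem (X u) (X j) (G u j) ⌊ u ≟ u ⌋ (S u ∧ right j) (keep j u) Xu (⌊≟⌋-refl u)
      where
      lem : ∀ a b g e k k' → a ≡ true → e ≡ true →
        g ∧ ((a ∧ (not b ∧ not (e ∨ k))) ∨ (b ∧ (not a ∧ not k'))) ≡ false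
      lem true b false true k k' _ _ = refl
      lem true true true true k k' _ _ = refl
      lem true false true true k k' _ _ = refl

    deg-v : deg H v ≡ suc n
    -- An edge from v into X can only end at u, where nothing is removed.
    deg-v = full-degree v λ j → lem (X v) (X j) (G v j) (keep v j) ⌊ u ≟ j ⌋ (S j ∧ right v) Xv
      λ Xj Gvj → trans (cong (λ z → ⌊ u ≟ z ⌋) (sym (proj₂ (proj₂ target) j Xj Gvj))) (⌊≟⌋-refl u)
      where
      lem : ∀ a b g k e k' → a ≡ false → (b ≡ true → g ≡ true → e ≡ true) →
        g ∧ ((a ∧ (not b ∧ not k)) ∨ (b ∧ (not a ∧ not (e ∨ k')))) ≡ false
      lem false b false k e k' _ h = refl
      lem false false true k e k' _ h = refl
      lem false true true k e k' _ h rewrite h refl refl = refl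

  ¬SMλ : ¬ SMλ H
  ¬SMλ (_ , menger) = <⇒≱ {t + r} {suc n} (s≤s (≤-reflexive (trans (+-comm t r) (sym n≡)))) (begin
    suc n ≡⟨ sym (⊓-idem (suc n)) ⟩
    suc n ⊓ suc n ≡⟨ sym (cong₂ _⊓_ deg-u deg-v) ⟩
    deg H u ⊓ deg H v ≤⟨ (let ps , _ , disjoint = menger u v u≢v in disjoint-walks≤cut X Xu Xv ps disjoint) ⟩
    cut H X ≡⟨ cutH ⟩
    t + r ∎)
    where
    open ≤-Reasoning
    u≢v : u ≢ v
    u≢v u≡v = true≢false Xu (trans (cong X u≡v) Xv)

-- Numerical facts and conclusion

V≡2^ : ∀ n → V n ≡ 2 ^ n
V≡2^ zero = refl
V≡2^ (suc n) = cong₂ _+_ (V≡2^ n) (trans (V≡2^ n) (sym (+-identityʳ (2 ^ n))))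

-- Since 1 + r ≤ 2^r, the right side is at least (1 + r)(1 + t). This makes the truncated
-- subtraction in the formula exact.
n≤V*t : ∀ r t → suc (r + t) ≤ V r * suc t
n≤V*t r t = begin
  suc (r + t) ≤⟨ m≤m+n (suc (r + t)) (r * t) ⟩
  suc (r + t) + r * t ≡⟨ eq r t ⟩
  suc r * suc t ≤⟨ *-monoˡ-≤ (suc t) (r<V r) ⟩
  V r * suc t ∎
  where
  open ≤-Reasoning
  eq : ∀ r t → suc (r + t) + r * t ≡ suc r * suc t
  eq = solve-∀
  r<V : ∀ r → suc r ≤ V r
  r<V zero = ≤-refl
  r<V (suc r) = +-mono-≤ (V≥1 r) (r<V r)

theorem3p2 : (n r : ℕ) → 3 ≤ n → 1 ≤ r → r ≤ n ∸ 2 →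
    (G : Adj (V n)) → HL n G → SmλrIs r G (2 ^ r * (n ∸ r) ∸ n)
theorem3p2 (suc zero) _ (s≤s ())
theorem3p2 (suc (suc n)) r _ 1≤r r≤n G hG@(hlS hA hB φ) =
  subst (SmλrIs r G) value (good , maximal)
  where
  -- The dimension is `suc (suc n)`, so `suc t` is the factor n - r of the formula.
  t = suc n ∸ r

  r≤1+n : r ≤ suc n
  r≤1+n = m≤n⇒m≤1+n r≤n

  1+n≡r+t : suc n ≡ r + t
  1+n≡r+t = sym (m+[n∸m]≡n r≤1+n)

  m = V r * suc t ∸ suc (suc n)

  value : m ≡ 2 ^ r * (suc (suc n) ∸ r) ∸ suc (suc n)
  value = cong (_∸ suc (suc n)) (cong₂ _*_ (V≡2^ r) (sym (+-∸-assoc 1 r≤1+n)))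

  n≤ : suc (suc n) ≤ V r * suc t
  n≤ = subst (_≤ V r * suc t) (cong suc (sym 1+n≡r+t)) (n≤V*t r t)

  good : SmGood r G m
  good F F⊆G few minDeg = SMλ-after-removal (cong suc 1+n≡r+t) n≤ hG F⊆G few minDeg 1≤r

  open Extremal 1+n≡r+t hA hB φ 1≤r

  -- The cut retains one edge fewer than the dimension, so F exceeds the claimed value by at most
  -- one and is admissible for every k > m.
  F-small : edgeCount F ≤ suc m
  F-small = +-cancelʳ-≤ (suc n) _ _ (begin
    edgeCount F + suc n ≡⟨ cong (edgeCount F +_) (trans 1+n≡r+t (+-comm r t)) ⟩
    edgeCount F + (t + r) ≤⟨ F-size ⟩
    suc t * V r ≡⟨ *-comm (suc t) (V r) ⟩
    V r * suc t ≡⟨ sym (m∸n+n≡m n≤) ⟩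
    m + suc (suc n) ≡⟨ +-suc m (suc n) ⟩
    suc m + suc n ∎)
    where open ≤-Reasoning

  maximal : ∀ k → SmGood r G k → k ≤ m
  maximal k k-good = ≮⇒≥ λ m<k → ¬SMλ (k-good F F⊆G (≤-trans F-small m<k) minDegree)
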